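{- Let $\alpha\ge1$ be an integer, $\varepsilon\in(0,1/2]$, $\beta=(\alpha+1)\cdot 108\alpha/\varepsilon$ and $n\ge\alpha+\beta$. Let $S_n$ be the number of blocks occupied by the $(\alpha,\varepsilon)$-Randomized Block Search Tree on $n$ keys with uniformly random priority permutation, and let $L=n/(\alpha S_n)$ be its load-factor. Then $$\mathbb{E}[S_n]\le(1+\varepsilon)\,n/\alpha ,$$ and the expected load-factor satisfies $\mathbb{E}[L]\ge 1-\varepsilon$.
   Context: $(\alpha,\varepsilon)$-RBST. Fix an integer $\alpha\ge1$ and a real $\varepsilon\in(0,1/2]$. Put $\rho=108\alpha/\varepsilon$ and $\beta=(\alpha+1)\rho$; the parameters are assumed to be such that $\beta$ is an integer. For an integer $s\ge0$ define the fan-out bound $\delta(s)=\min\{\alpha+1,\max\{1,\lceil (s-\alpha)/\rho\rceil\}\}$. Let $X$ be a set of $n$ distinct keys from a totally ordered universe and let $\pi:X\to\{1,\dots,n\}$ be a bijection (the priorities), drawn uniformly at random. The tree $T_X(\pi)$ is a rooted tree of blocks, each holding at most $\alpha$ keys, defined recursively for any subset $Y\subseteq X$, $|Y|=s$, arising in the construction (starting with $Y=X$): if $Y=\emptyset$ there is no block; otherwise the root block of the subtree for $Y$ stores the $\min\{\alpha,s\}$ keys of $Y$ of smallest priority. If $s\le\alpha$ this is the only block of the subtree. If $s>\alpha$, the $\delta(s)-1$ keys of smallest priority in $Y$ are the active separators of this block; the remaining $s-\alpha$ keys (those not stored in the block) are partitioned by the active separators, in key order, into $\delta(s)$ (possibly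 empty) sections, and the subtree of each non-empty section, built recursively, becomes a child of the block. -}

module Defs where

open import Data.Bool.Base using (if_then_else_)
open import Data.Fin.Base using (Fin; zero; suc; punchIn)
open import Data.Fin.Permutation as Perm using (Permutation′; _⟨$⟩ʳ_; _⟨$⟩ˡ_)
open import Data.Integer.Base as ℤ using (+_)
open import Data.List.Base
  using (List; []; _∷_; length; map; foldr; filter; take; drop; upTo; allFin; mapMaybe; cartesianProductWith)
open import Data.List.Properties using (length-++; length-map; length-tabulate; length-drop; length-filter)
open import Data.List.Membership.Propositional using (_∈_)
open import Data.List.Membership.Propositional.Properties using (∈-allFin)
open import Data.List.Relation.Unary.Any using (Any; here; there)
open import Data.List.Relation.Unary.Any.Properties using (cartesianProductWith⁺)
open import Data.Maybe.Base using (Maybe; just; nothing; maybe′)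
open import Data.Nat.Base as ℕ using (ℕ; zero; suc; NonZero; _!; z≤n; s≤s)
open import Data.Nat.Induction using (Acc; acc; <-wellFounded)
open import Data.Nat.Properties as ℕ using (_≤?_; m*n≢0; _!≢0; m∸n≤m)
open import Data.Rational.Base as ℚ using (ℚ; 0ℚ; _/_; _÷_; ceiling)
open import Data.Rational.Properties as ℚ
  using (normalize-pos; pos*pos⇒pos; 1/pos⇒pos; pos⇒nonZero)
open import Relation.Binary.Bundles using (StrictTotalOrder)
open import Relation.Binary.PropositionalEquality
  using (_≡_; refl; sym; trans; cong; cong₂; subst)
open import Relation.Nullary.Decidable using (does)

fromℕ : ℕ → ℚ
fromℕ k = + k / 1

------------------------------------------------------------------------
-- Parameters
--
-- ε is taken in ℚ: β = (α + 1) · 108α / ε is assumed to be an integer, so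
-- ε = 108α(α + 1) / β is rational and no real parameter is lost.

module _ (α : ℕ) .{{_ : NonZero α}} (ε : ℚ) .{{_ : ℚ.Positive ε}} where

  private instance
    ε≢0 : ℚ.NonZero ε
    ε≢0 = pos⇒nonZero ε

  ρ : ℚ
  ρ = fromℕ (108 ℕ.* α) ÷ ε

  ρ≢0 : ℚ.NonZero ρ
  ρ≢0 = pos⇒nonZero ρ {{pos*pos⇒pos (fromℕ (108 ℕ.* α)) {{108α>0}} (ℚ.1/ ε) {{1/pos⇒pos ε}}}}
    where
    108α>0 : ℚ.Positive (fromℕ (108 ℕ.* α))
    108α>0 = normalize-pos (108 ℕ.* α) 1 {{_}} {{m*n≢0 108 α}}

  -- The value of max {1 , ⌈ (s - α) / ρ ⌉} is positive, so ∣_∣ only changes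
  -- its type from ℤ to ℕ.
  δ : ℕ → ℕ
  δ s = suc α ℕ.⊓ ℤ.∣ + 1 ℤ.⊔ ceiling (_÷_ (fromℕ s ℚ.- fromℕ α) ρ {{ρ≢0}}) ∣

------------------------------------------------------------------------
-- Trees of blocks

data Tree {k} (Key : Set k) : Set k where
  block : (keys separators : List Key) (children : List (Tree Key)) → Tree Key

module _ {k} {Key : Set k} where

  blocks       : Tree Key → ℕ
  blocksForest : List (Tree Key) → ℕ

  blocks (block _ _ ts) = suc (blocksForest ts)

  blocksForest []       = 0
  blocksForest (t ∷ ts) = blocks t ℕ.+ blocksForest ts

module RBST {c ℓ₁ ℓ₂} (U : StrictTotalOrder c ℓ₁ ℓ₂)
            (α : ℕ) .{{_ : NonZero α}} (ε : ℚ) .{{_ : ℚ.Positive ε}} where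

  open StrictTotalOrder U using (_<?_) renaming (Carrier to Key)

  -- The separators z₁ < ⋯ < z_d cut the keys into the d + 1 sections
  -- (-∞ , z₁), (z₁ , z₂), …, (z_d , ∞); the j-th of them (counting from 0)
  -- consists of the keys that lie above exactly j separators.
  rank : List Key → Key → ℕ
  rank separators y = length (filter (_<? y) separators)

  section : List Key → List Key → ℕ → List Key
  section separators ys j = filter (λ y → rank separators y ℕ.≟ j) ys

  section-shrinks : ∀ seps y ys j →
    length (section seps (drop α (y ∷ ys)) j) ℕ.< length (y ∷ ys)
  section-shrinks seps y ys j =
    ℕ.≤-<-trans (length-filter (λ z → rank seps z ℕ.≟ j) (drop α (y ∷ ys))) (drop-shrinks α)
    where
    drop-shrinks : ∀ a .{{_ : NonZero a}} → length (drop a (y ∷ ys)) ℕ.< length (y ∷ ys)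
    drop-shrinks (suc a) =
      s≤s (subst (ℕ._≤ length ys) (sym (length-drop a ys)) (m∸n≤m (length ys) a))

  -- A set Y of keys is represented by the list of its elements in order of
  -- increasing priority, so the m keys of smallest priority are `take m Y`.
  -- This order is inherited by the sections, since `filter` is stable.
  -- The result is `nothing` exactly when Y is empty.
  build : (Y : List Key) → Acc ℕ._<_ (length Y) → Maybe (Tree Key)
  build []           _         = nothing
  build Y@(y ∷ ys) (acc rec) =
    just (if does (length Y ≤? α)
          then block Y [] []
          else block (take α Y) separators
                 (mapMaybe (λ j → build (section separators (drop α Y) j)
                                        (rec (section-shrinks separators y ys j)))
                           (upTo d)))
    where
    d          = δ α ε (length Y)
    separators = take (d ℕ.∸ 1) Y

  -- The key set is X = {x 0 , … , x (n - 1)}, and π maps the index of a key to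
  -- its priority.
  byPriority : ∀ {n} → (Fin n → Key) → Permutation′ n → List Key
  byPriority {n} x π = map (λ p → x (π ⟨$⟩ˡ p)) (allFin n)

  tree : ∀ {n} → (Fin n → Key) → Permutation′ n → Maybe (Tree Key)
  tree x π = build (byPriority x π) (<-wellFounded _)

  size : ∀ {n} → (Fin n → Key) → Permutation′ n → ℕ
  size x π = maybe′ blocks 0 (tree x π)

  -- n / (α S); the size S is 0 only when there are no keys, and the value there
  -- is a convention.
  loadFactor : ∀ {n} → (Fin n → Key) → Permutation′ n → ℚ
  loadFactor {n} x π with size x π
  ... | zero  = 0ℚ
  ... | suc s = _/_ (+ n) (α ℕ.* suc s) {{m*n≢0 α (suc s)}}

------------------------------------------------------------------------
-- Expectation over a uniformly random permutation

permutations : ∀ n → List (Permutation′ n)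
permutations zero    = Perm.id ∷ []
permutations (suc n) =
  cartesianProductWith (Perm.insert zero) (allFin (suc n)) (permutations n)

𝔼 : ∀ {n} → (Permutation′ n → ℚ) → ℚ
𝔼 {n} f = foldr ℚ._+_ 0ℚ (map f (permutations n)) ℚ.* (_/_ (+ 1) (n !) {{n !≢0}})

-- The list contains every permutation and has n ! entries, so it contains each
-- permutation exactly once and 𝔼 is the uniform average.

permutations-complete : ∀ {n} (π : Permutation′ n) → Any (Perm._≈_ π) (permutations n)
permutations-complete {zero}  π = here λ ()
permutations-complete {suc n} π =
  cartesianProductWith⁺ (Perm.insert zero) (λ {j} {σ} → glue {j} {σ})
    (∈-allFin (π ⟨$⟩ʳ zero)) (permutations-complete (Perm.remove zero π))
  where
  insert-cong : ∀ {j} {σ τ : Permutation′ n} → σ Perm.≈ τ →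
                Perm.insert zero j σ Perm.≈ Perm.insert zero j τ
  insert-cong {j} {σ} {τ} σ≈τ zero    = refl
  insert-cong {j} {σ} {τ} σ≈τ (suc i) =
    trans (Perm.insert-punchIn zero j σ i)
      (trans (cong (punchIn j) (σ≈τ i)) (sym (Perm.insert-punchIn zero j τ i)))

  glue : ∀ {j} {σ : Permutation′ n} → π ⟨$⟩ʳ zero ≡ j → Perm.remove zero π Perm.≈ σ →
         π Perm.≈ Perm.insert zero j σ
  glue {σ = σ} refl eq i =
    trans (sym (Perm.insert-remove zero π i)) (insert-cong {τ = σ} eq i)

length-permutations : ∀ n → length (permutations n) ≡ n !
length-permutations zero    = refl
length-permutations (suc n) =
  trans (length-product (allFin (suc n)))
        (cong₂ ℕ._*_ (length-tabulate {n = suc n} (λ i → i)) (length-permutations n))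
  where
  length-product : ∀ is → length (cartesianProductWith (Perm.insert zero) is (permutations n))
                          ≡ length is ℕ.* length (permutations n)
  length-product []       = refl
  length-product (i ∷ is) =
    trans (length-++ (map (Perm.insert zero i) (permutations n)))
          (cong₂ ℕ._+_ (length-map (Perm.insert zero i) (permutations n)) (length-product is))

{-# OPTIONS --safe #-}
-- A block with children is full, so only leaf blocks waste space and it is
-- enough to have few of them.  Put c = 108.  By induction on s, a tree on s
-- uniformly ordered keys has on average at most s / α + max (1 , c s / ρ - 1)
-- blocks: once the α keys of the root are fixed, each section is again
-- uniformly ordered, so the induction hypothesis applies to it.  If there are
-- d ≥ 2 sections of sizes M_j, then Σ max (1 , c M_j / ρ - 1) is at most
-- c (s - α) / ρ - d plus twice the number of sections smaller than 2 ρ / c,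
-- and that number is at most (d - 1) / 2 on average: when the separators are
-- drawn one after the other, one of them can only create a section smaller than
-- T if it is among the T least or the T greatest keys of its section, while
-- s - α > (d - 1) ρ keys are available.  With c / ρ = ε / α this gives the bound
-- on E[S] for s = n, and E[L] ≥ 1 - ε follows from L + α S / n = L + 1 / L ≥ 2.
module Submission where

open import Defs

-- The subtracted 1 makes the bound reproduce itself. The α keys of a root pay for its own block, so
-- the terms max (1 , c M_j / ρ - 1) of the sections only have to add up, on average, to at most the
-- term of s. A penalty of 2 for an expected number (d - 1) / 2 of small sections costs d - 1, so of
-- the d units subtracted exactly one is left.
--
-- One gap must be bridged. Small sections are counted after all α keys of the root are gone, but
-- only d - 1 of these keys separate; the others may thin out the sections. So the threshold is
-- about ρ / 4 - α for the final sections and at most ρ / 4 when the separators are drawn; c ≥ 12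
-- and ρ ≥ 2 c α leave enough room between 2 ρ / c and ρ / 4 for this and for rounding.
--
-- To stay in ℕ, expectations are sums over ordered selections by position, and the inequalities are
-- multiplied by α β and by factorials or falling factorials.

module Counting where

  open import Data.Bool.Base using (if_then_else_; true; false)
  open import Data.Fin.Base using (Fin; zero; suc; punchIn; toℕ)
  open import Data.Fin.Permutation as Perm using (Permutation′; _⟨$⟩ʳ_; _⟨$⟩ˡ_)
  open import Data.List.Base
    using (List; []; _∷_; _++_; _∷ʳ_; [_]; length; map; mapMaybe; filter;
           take; drop; upTo; tabulate; allFin; cartesianProductWith)
  open import Data.List.Properties hiding (sum-++)
  open import Data.List.Membership.Propositional using (_∈_)
  open import Data.List.Membership.Propositional.Properties using (∈-map⁻; ∈-filter⁻)
  import Data.List.Relation.Unary.All as All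
  open import Data.List.Relation.Unary.AllPairs as AllPairs using (AllPairs; []; _∷_)
  import Data.List.Relation.Unary.AllPairs.Properties as AllPairs
  open import Data.List.Relation.Unary.Any using (here; there)
  open import Data.List.Relation.Binary.Permutation.Propositional as ↭
    using (_↭_; ↭-refl; ↭-trans; prep; ↭⇒↭ₛ)
  open import Data.List.Relation.Binary.Permutation.Propositional.Properties using (↭-length; filter-↭)
  import Data.List.Relation.Binary.Permutation.Setoid.Properties as ↭ₛ
  open import Data.Maybe.Base using (Maybe; just; nothing; maybe′)
  open import Data.Nat.Base hiding (_/_)
  open import Data.Nat.DivMod using (_/_; m/n*n≤m; m≡m%n+[m/n]*n; m%n<n)
  open import Data.Nat.Induction using (Acc; acc; <-wellFounded)
  open import Data.Nat.ListAction using (sum)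
  open import Data.Nat.ListAction.Properties using (sum-++)
  open import Data.Nat.Properties as ℕ hiding (_<?_)
  open import Data.Nat.Tactic.RingSolver using (solve-∀)
  open import Data.Product.Base using (_×_; _,_; proj₁; proj₂; ∃)
  open import Data.Rational.Base using (ℚ; Positive)
  open import Data.Sum.Base as Sum using (_⊎_; inj₁; inj₂; [_,_]′)
  open import Function.Base using (_∘_; id; flip)
  open import Level as Level using (Level)
  open import Relation.Binary.Bundles using (StrictTotalOrder)
  open import Relation.Binary.Core using (Rel)
  import Relation.Binary.Definitions as B
  open import Relation.Binary.PropositionalEquality hiding ([_])
  open import Relation.Nullary using (¬_; Dec; yes; no; contradiction; does)
  open import Relation.Nullary.Decidable using (dec-true; dec-false)
  open import Relation.Unary using (Decidable; Pred)

  private variable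
    a b ℓ : Level
    A : Set a
    B : Set b

  -- Finite sums of natural numbers over lists.

  *-swap : ∀ a b c → a * (b * c) ≡ b * (a * c)
  *-swap = solve-∀

  ∑ : List A → (A → ℕ) → ℕ
  ∑ xs f = sum (map f xs)

  ∑-cong-∈ : ∀ (xs : List A) {f g : A → ℕ} → (∀ {x} → x ∈ xs → f x ≡ g x) → ∑ xs f ≡ ∑ xs g
  ∑-cong-∈ []       f≗g = refl
  ∑-cong-∈ (x ∷ xs) f≗g = cong₂ _+_ (f≗g (here refl)) (∑-cong-∈ xs (f≗g ∘ there))

  ∑-cong : ∀ (xs : List A) {f g : A → ℕ} → (∀ x → f x ≡ g x) → ∑ xs f ≡ ∑ xs g
  ∑-cong xs f≗g = ∑-cong-∈ xs λ {x} _ → f≗g x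

  ∑-mono : ∀ (xs : List A) {f g : A → ℕ} → (∀ {x} → x ∈ xs → f x ≤ g x) → ∑ xs f ≤ ∑ xs g
  ∑-mono []       f≤g = z≤n
  ∑-mono (x ∷ xs) f≤g = +-mono-≤ (f≤g (here refl)) (∑-mono xs (f≤g ∘ there))

  ∑-++ : ∀ (xs ys : List A) f → ∑ (xs ++ ys) f ≡ ∑ xs f + ∑ ys f
  ∑-++ xs ys f = trans (cong sum (map-++ f xs ys)) (sum-++ (map f xs) (map f ys))

  ∑-map : ∀ (g : A → B) xs f → ∑ (map g xs) f ≡ ∑ xs (f ∘ g)
  ∑-map g xs f = cong sum (sym (map-∘ xs))

  ∑-+ : ∀ (xs : List A) f g → ∑ xs (λ x → f x + g x) ≡ ∑ xs f + ∑ xs g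
  ∑-+ []       f g = refl
  ∑-+ (x ∷ xs) f g = trans (cong (f x + g x +_) (∑-+ xs f g)) (lemma (f x) (g x) _ _)
    where
    lemma : ∀ a b c d → a + b + (c + d) ≡ a + c + (b + d)
    lemma = solve-∀

  ∑-* : ∀ c (xs : List A) f → ∑ xs (λ x → c * f x) ≡ c * ∑ xs f
  ∑-* c []       f = sym (*-zeroʳ c)
  ∑-* c (x ∷ xs) f = trans (cong (c * f x +_) (∑-* c xs f)) (sym (*-distribˡ-+ c (f x) _))

  ∑-const : ∀ (xs : List A) c → ∑ xs (λ _ → c) ≡ length xs * c
  ∑-const []       c = refl
  ∑-const (x ∷ xs) c = cong (c +_) (∑-const xs c)

  ∑-swap : ∀ (xs : List A) (ys : List B) (f : A → B → ℕ) →
           ∑ xs (λ x → ∑ ys (f x)) ≡ ∑ ys (λ y → ∑ xs (λ x → f x y))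
  ∑-swap []       ys f = trans (sym (*-zeroʳ (length ys))) (sym (∑-const ys 0))
  ∑-swap (x ∷ xs) ys f = trans (cong (∑ ys (f x) +_) (∑-swap xs ys f)) (sym (∑-+ ys (f x) _))

  ∑-upTo-suc : ∀ n f → ∑ (upTo (suc n)) f ≡ f 0 + ∑ (upTo n) (f ∘ suc)
  ∑-upTo-suc n f = cong (λ l → f 0 + sum l)
    (trans (map-applyUpTo suc f n) (sym (map-applyUpTo id (f ∘ suc) n)))

  -- Ordered selections and falling factorials.

  picks : List A → List (A × List A)
  picks []       = []
  picks (x ∷ xs) = (x , xs) ∷ map (λ (y , ys) → y , x ∷ ys) (picks xs)

  ∑-picks-∷ : ∀ (x : A) xs (f : A × List A → ℕ) →
              ∑ (picks (x ∷ xs)) f ≡ f (x , xs) + ∑ (picks xs) (λ (y , ys) → f (y , x ∷ ys))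
  ∑-picks-∷ x xs f = cong (f (x , xs) +_) (∑-map _ (picks xs) f)

  ∑-picks-proj₁ : ∀ (xs : List A) f → ∑ (picks xs) (f ∘ proj₁) ≡ ∑ xs f
  ∑-picks-proj₁ []       f = refl
  ∑-picks-proj₁ (x ∷ xs) f =
    trans (∑-picks-∷ x xs (f ∘ proj₁)) (cong (f x +_) (∑-picks-proj₁ xs f))

  length-picks : ∀ (xs : List A) → length (picks xs) ≡ length xs
  length-picks []       = refl
  length-picks (x ∷ xs) = cong suc (trans (length-map _ (picks xs)) (length-picks xs))

  picks-↭ : ∀ {y ys} (xs : List A) → (y , ys) ∈ picks xs → xs ↭ y ∷ ys
  picks-↭ (x ∷ xs) (here refl) = ↭-refl
  picks-↭ (x ∷ xs) (there q) with ∈-map⁻ _ q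
  ... | _ , q′ , refl = ↭-trans (prep x (picks-↭ xs q′)) (↭.swap x _ ↭-refl)

  -- The sum of F p r over the ordered selections p of n entries of a list
  -- (by position), r being the list of the entries that are left.
  ∑sel : ℕ → (List A → List A → ℕ) → List A → ℕ
  ∑sel zero    F xs = F [] xs
  ∑sel (suc n) F xs = ∑ (picks xs) λ (x , r) → ∑sel n (λ p → F (x ∷ p)) r

  ∑perm : (List A → ℕ) → List A → ℕ
  ∑perm F xs = ∑sel (length xs) (λ p _ → F p) xs

  -- The hypothesis hands over `xs ↭ p ++ r`, which is how the number and the distinctness of the
  -- keys left over become known inside a sum.
  ∑sel-mono : ∀ n {F G : List A → List A → ℕ} xs →
              (∀ p r → length p ≡ n → xs ↭ p ++ r → F p r ≤ G p r) → ∑sel n F xs ≤ ∑sel n G xs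
  ∑sel-mono zero    xs h = h [] xs refl ↭-refl
  ∑sel-mono (suc n) xs h = ∑-mono (picks xs) λ {(x , r)} x∈ →
    ∑sel-mono n r λ p r′ |p| r↭ → h (x ∷ p) r′ (cong suc |p|) (↭-trans (picks-↭ xs x∈) (prep x r↭))

  ∑sel-cong : ∀ n {F G : List A → List A → ℕ} xs → (∀ p r → length p ≡ n → F p r ≡ G p r) →
              ∑sel n F xs ≡ ∑sel n G xs
  ∑sel-cong n xs h = ≤-antisym (∑sel-mono n xs λ p r |p| _ → ≤-reflexive (h p r |p|))
                               (∑sel-mono n xs λ p r |p| _ → ≤-reflexive (sym (h p r |p|)))

  ∑sel-+ : ∀ n F G (xs : List A) →
           ∑sel n (λ p r → F p r + G p r) xs ≡ ∑sel n F xs + ∑sel n G xs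
  ∑sel-+ zero    F G xs = refl
  ∑sel-+ (suc n) F G xs =
    trans (∑-cong (picks xs) λ (x , r) → ∑sel-+ n (F ∘ (x ∷_)) (G ∘ (x ∷_)) r)
          (∑-+ (picks xs) _ _)

  ∑sel-* : ∀ n c F (xs : List A) → ∑sel n (λ p r → c * F p r) xs ≡ c * ∑sel n F xs
  ∑sel-* zero    c F xs = refl
  ∑sel-* (suc n) c F xs =
    trans (∑-cong (picks xs) λ (x , r) → ∑sel-* n c (F ∘ (x ∷_)) r) (∑-* c (picks xs) _)

  ∑sel-∑ : ∀ n (js : List B) (F : B → List A → List A → ℕ) xs →
           ∑sel n (λ p r → ∑ js (λ j → F j p r)) xs ≡ ∑ js (λ j → ∑sel n (F j) xs)
  ∑sel-∑ zero    js F xs = refl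
  ∑sel-∑ (suc n) js F xs =
    trans (∑-cong (picks xs) λ (x , r) → ∑sel-∑ n js (λ j → F j ∘ (x ∷_)) r)
          (∑-swap (picks xs) js _)

  -- Conditioning on a prefix: with `m` equal to `α`, the outer sum fixes the keys of the root and
  -- the inner one orders the others.
  ∑sel-∘ : ∀ m n (F : List A → List A → ℕ) xs →
           ∑sel (m + n) F xs ≡ ∑sel m (λ p → ∑sel n (λ q → F (p ++ q))) xs
  ∑sel-∘ zero    n F xs = refl
  ∑sel-∘ (suc m) n F xs = ∑-cong (picks xs) λ (x , r) → ∑sel-∘ m n (F ∘ (x ∷_)) r

  -- The falling factorial s (s - 1) ⋯ (s - n + 1), the number of ordered selections of `n` out of
  -- `s` entries.
  fall : ℕ → ℕ → ℕ
  fall s zero    = 1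
  fall s (suc n) = s * fall (pred s) n

  fall-! : ∀ n m → fall (n + m) n * m ! ≡ (n + m) !
  fall-! zero    m = *-identityˡ (m !)
  fall-! (suc n) m = trans (*-assoc (suc (n + m)) (fall (n + m) n) (m !)) (cong (suc (n + m) *_) (fall-! n m))

  ∑sel-const : ∀ n c (xs : List A) → ∑sel n (λ _ _ → c) xs ≡ fall (length xs) n * c
  ∑sel-const zero    c xs = sym (*-identityˡ c)
  ∑sel-const (suc n) c xs = begin
    ∑ (picks xs) (λ (x , r) → ∑sel n (λ _ _ → c) r)
      ≡⟨ ∑-cong-∈ (picks xs) step ⟩
    ∑ (picks xs) (λ _ → fall (pred (length xs)) n * c)
      ≡⟨ ∑-const (picks xs) _ ⟩
    length (picks xs) * (fall (pred (length xs)) n * c)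
      ≡⟨ cong (_* (fall (pred (length xs)) n * c)) (length-picks xs) ⟩
    length xs * (fall (pred (length xs)) n * c)
      ≡⟨ *-assoc (length xs) _ c ⟨
    length xs * fall (pred (length xs)) n * c ∎
    where
    open ≡-Reasoning
    step : ∀ {q} → q ∈ picks xs → ∑sel n (λ _ _ → c) (proj₂ q) ≡ fall (pred (length xs)) n * c
    step {x , r} q∈ = trans (∑sel-const n c r)
      (cong (λ k → fall (pred k) n * c) (sym (↭-length (picks-↭ xs q∈))))

  -- From `permutations` to sums over ordered selections.

  putAt : ℕ → A → List A → List A
  putAt zero    x xs       = x ∷ xs
  putAt (suc j) x []       = x ∷ []
  putAt (suc j) x (y ∷ xs) = y ∷ putAt j x xs

  -- Choosing the position of x in a permutation of the rest is choosing, one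
  -- position after the other, which entry comes next.
  ∑sel-putAt : ∀ n (F : List A → ℕ) x xs → length xs ≡ n →
    ∑ (upTo (suc n)) (λ j → ∑sel n (λ p _ → F (putAt j x p)) xs)
    ≡ ∑sel (suc n) (λ p _ → F p) (x ∷ xs)
  ∑sel-putAt zero    F x []  refl = refl
  ∑sel-putAt (suc n) F x xs |xs| = begin
    ∑ (upTo (2 + n)) (λ j → ∑sel (suc n) (λ p _ → F (putAt j x p)) xs)
      ≡⟨ ∑-upTo-suc (suc n) (λ j → ∑sel (suc n) (λ p _ → F (putAt j x p)) xs) ⟩
    first + ∑ (upTo (suc n)) (λ j → ∑ (picks xs) λ (y , r) → ∑sel n (λ p _ → F (y ∷ putAt j x p)) r)
      ≡⟨ cong (first +_) (∑-swap (upTo (suc n)) (picks xs) _) ⟩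
    first + ∑ (picks xs) (λ (y , r) → ∑ (upTo (suc n)) λ j → ∑sel n (λ p _ → F (y ∷ putAt j x p)) r)
      ≡⟨ cong (first +_) (∑-cong-∈ (picks xs) step) ⟩
    first + ∑ (picks xs) (λ (y , r) → ∑sel (suc n) (λ p _ → F (y ∷ p)) (x ∷ r))
      ≡⟨ ∑-picks-∷ x xs (λ (y , r) → ∑sel (suc n) (λ p _ → F (y ∷ p)) r) ⟨
    ∑sel (2 + n) (λ p _ → F p) (x ∷ xs) ∎
    where
    open ≡-Reasoning
    first = ∑sel (suc n) (λ p _ → F (x ∷ p)) xs
    step : ∀ {q} → q ∈ picks xs →
           ∑ (upTo (suc n)) (λ j → ∑sel n (λ p _ → F (proj₁ q ∷ putAt j x p)) (proj₂ q))
           ≡ ∑sel (suc n) (λ p _ → F (proj₁ q ∷ p)) (x ∷ proj₂ q)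
    step {y , r} q∈ = ∑sel-putAt n (F ∘ (y ∷_)) x r
      (suc-injective (trans (sym (↭-length (picks-↭ xs q∈))) |xs|))

  ∑-cartesianProductWith : ∀ {c} {C : Set c} (f : A → B → C) xs ys g →
    ∑ (cartesianProductWith f xs ys) g ≡ ∑ xs (λ x → ∑ ys (λ y → g (f x y)))
  ∑-cartesianProductWith f []       ys g = refl
  ∑-cartesianProductWith f (x ∷ xs) ys g =
    trans (∑-++ (map (f x) ys) _ g)
          (cong₂ _+_ (∑-map (f x) ys g) (∑-cartesianProductWith f xs ys g))

  ∑-allFin : ∀ n f → ∑ (allFin n) (f ∘ toℕ) ≡ ∑ (upTo n) f
  ∑-allFin zero    f = refl
  ∑-allFin (suc n) f = begin
    f 0 + ∑ (tabulate {n = n} suc) (f ∘ toℕ)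
      ≡⟨ cong (λ is → f 0 + ∑ is (f ∘ toℕ)) (map-tabulate {n = n} id suc) ⟨
    f 0 + ∑ (map suc (allFin n)) (f ∘ toℕ)
      ≡⟨ cong (f 0 +_) (trans (∑-map suc (allFin n) (f ∘ toℕ)) (∑-allFin n (f ∘ suc))) ⟩
    f 0 + ∑ (upTo n) (f ∘ suc)
      ≡⟨ ∑-upTo-suc n f ⟨
    ∑ (upTo (suc n)) f ∎
    where open ≡-Reasoning

  tabulate-putAt : ∀ {n} (f : Fin (suc n) → A) j g → (∀ k → f (punchIn j k) ≡ g k) →
                   tabulate f ≡ putAt (toℕ j) (f j) (tabulate g)
  tabulate-putAt f zero g h = cong (f zero ∷_) (tabulate-cong h)
  tabulate-putAt {n = suc n} f (suc j) g h =
    cong₂ _∷_ (h zero) (tabulate-putAt (f ∘ suc) j (g ∘ suc) (h ∘ suc))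

  -- `permutations` first chooses the priority of key 0 and then orders the other keys, whereas
  -- `∑perm` first chooses the key of least priority. In the priority order, giving key 0 the
  -- priority `j` is `putAt j`, so `∑sel-putAt` converts one scheme into the other.
  ∑-permutations : ∀ n (x : Fin n → A) (G : List A → ℕ) →
    ∑ (permutations n) (λ π → G (map (λ p → x (π ⟨$⟩ˡ p)) (allFin n)))
    ≡ ∑perm G (tabulate x)
  ∑-permutations zero    x G = +-identityʳ (G [])
  ∑-permutations (suc n) x G = begin
    ∑ (permutations (suc n)) (λ π → G (order x π))
      ≡⟨ ∑-cartesianProductWith (Perm.insert zero) (allFin (suc n)) (permutations n) (λ π → G (order x π)) ⟩
    ∑ (allFin (suc n)) (λ j → ∑ (permutations n) (λ σ → G (order x (Perm.insert zero j σ))))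
      ≡⟨ ∑-cong (allFin (suc n)) (λ j → trans
           (∑-cong (permutations n) (λ σ → cong G (order-insert j σ)))
           (∑-permutations n (x ∘ suc) (G ∘ putAt (toℕ j) (x zero)))) ⟩
    ∑ (allFin (suc n)) (λ j → ∑perm (G ∘ putAt (toℕ j) (x zero)) xs)
      ≡⟨ ∑-allFin (suc n) (λ j → ∑perm (G ∘ putAt j (x zero)) xs) ⟩
    ∑ (upTo (suc n)) (λ j → ∑perm (G ∘ putAt j (x zero)) xs)
      ≡⟨ cong (λ k → ∑ (upTo (suc k)) (λ j → ∑perm (G ∘ putAt j (x zero)) xs)) (length-tabulate (x ∘ suc)) ⟨
    ∑ (upTo (suc (length xs))) (λ j → ∑perm (G ∘ putAt j (x zero)) xs)
      ≡⟨ ∑sel-putAt (length xs) G (x zero) xs refl ⟩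
    ∑perm G (tabulate x) ∎
    where
    open ≡-Reasoning
    xs = tabulate (x ∘ suc)
    order : ∀ {n} → (Fin n → _) → Permutation′ n → List _
    order {n} x π = map (λ p → x (π ⟨$⟩ˡ p)) (allFin n)
    order-insert : ∀ j σ → order x (Perm.insert zero j σ) ≡ putAt (toℕ j) (x zero) (order (x ∘ suc) σ)
    order-insert j σ = begin
      order x π                                             ≡⟨ map-tabulate id _ ⟩
      tabulate (λ p → x (π ⟨$⟩ˡ p))                         ≡⟨ tabulate-putAt (λ p → x (π ⟨$⟩ˡ p)) j (λ p → x (suc (σ ⟨$⟩ˡ p))) (λ k → cong x (below k)) ⟩
      putAt (toℕ j) (x (π ⟨$⟩ˡ j)) (tabulate λ p → x (suc (σ ⟨$⟩ˡ p)))
        ≡⟨ cong₂ (putAt (toℕ j)) (cong x (Perm.inverseˡ π)) (sym (map-tabulate id _)) ⟩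
      putAt (toℕ j) (x zero) (order (x ∘ suc) σ)            ∎
      where
      π = Perm.insert zero j σ
      below : ∀ k → π ⟨$⟩ˡ punchIn j k ≡ suc (σ ⟨$⟩ˡ k)
      below k = begin
        π ⟨$⟩ˡ punchIn j k                       ≡⟨ cong (λ l → π ⟨$⟩ˡ punchIn j l) (Perm.inverseʳ σ) ⟨
        π ⟨$⟩ˡ punchIn j (σ ⟨$⟩ʳ (σ ⟨$⟩ˡ k))     ≡⟨ cong (π ⟨$⟩ˡ_) (Perm.insert-punchIn zero j σ (σ ⟨$⟩ˡ k)) ⟨
        π ⟨$⟩ˡ (π ⟨$⟩ʳ suc (σ ⟨$⟩ˡ k))           ≡⟨ Perm.inverseˡ π ⟩
        suc (σ ⟨$⟩ˡ k)                           ∎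

  -- The order induced on a filtered list.

  module _ {P : Pred A ℓ} (P? : Decidable P) where

    misses : List A → ℕ
    misses xs = ∑ xs (λ x → if does (P? x) then 0 else 1)

    length-filter+misses : ∀ xs → length (filter P? xs) + misses xs ≡ length xs
    length-filter+misses []       = refl
    length-filter+misses (x ∷ xs) with does (P? x)
    ... | true  = cong suc (length-filter+misses xs)
    ... | false = trans (+-suc _ _) (cong suc (length-filter+misses xs))

    -- A pick outside `P` leaves `filter P? xs` unchanged, so all `misses xs` of them contribute the
    -- same value; the others are the picks of the filtered list.
    ∑-picks-filter : ∀ (h : A → List A → ℕ) (g : List A → ℕ) xs →
      ∑ (picks xs) (λ (x , r) → if does (P? x) then h x (filter P? r) else g (filter P? r))
      ≡ ∑ (picks (filter P? xs)) (λ (x , r) → h x r) + misses xs * g (filter P? xs)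
    ∑-picks-filter h g []       = refl
    ∑-picks-filter h g (y ∷ xs)
      rewrite ∑-picks-∷ y xs (λ (x , r) → if does (P? x) then h x (filter P? r) else g (filter P? r))
      with does (P? y)
    ... | true  rewrite ∑-picks-∷ y (filter P? xs) (λ (x , r) → h x r) =
          trans (cong (h y (filter P? xs) +_) (∑-picks-filter (λ x r → h x (y ∷ r)) (g ∘ (y ∷_)) xs))
                (sym (+-assoc (h y (filter P? xs)) _ _))
    ... | false =
          trans (cong (g (filter P? xs) +_) (∑-picks-filter h g xs))
                (lemma (g (filter P? xs)) (∑ (picks (filter P? xs)) (λ (x , r) → h x r)) (misses xs))
      where
      lemma : ∀ c d e → c + (d + e * c) ≡ d + (c + e * c)
      lemma = solve-∀

    -- A uniformly random permutation of a list induces one of a sublist.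
    ∑perm-filter : ∀ n (F : List A → ℕ) xs → length xs ≡ n →
      length (filter P? xs) ! * ∑sel n (λ p _ → F (filter P? p)) xs ≡ n ! * ∑perm F (filter P? xs)
    ∑perm-filter zero    F []  refl = refl
    ∑perm-filter (suc n) F xs |xs| = begin
      m ! * ∑ (picks xs) (λ (x , r) → ∑sel n (λ p _ → F (filter P? (x ∷ p))) r)
        ≡⟨ ∑-* (m !) (picks xs) (λ (x , r) → ∑sel n (λ p _ → F (filter P? (x ∷ p))) r) ⟨
      ∑ (picks xs) (λ (x , r) → m ! * ∑sel n (λ p _ → F (filter P? (x ∷ p))) r)
        ≡⟨ ∑-cong-∈ (picks xs) step ⟩
      ∑ (picks xs) (λ (x , r) → if does (P? x) then h x (filter P? r) else g (filter P? r))
        ≡⟨ ∑-picks-filter h g xs ⟩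
      ∑ (picks ys) (λ (x , r) → h x r) + misses xs * g ys
        ≡⟨ cong (_+ misses xs * g ys) (trans
             (∑-* (n !) (picks ys) (λ (x , r) → m * ∑perm (F ∘ (x ∷_)) r))
             (cong (n ! *_) (trans (∑-* m (picks ys) (λ (x , r) → ∑perm (F ∘ (x ∷_)) r)) (unpick ys)))) ⟩
      n ! * (m * ∑perm F ys) + misses xs * (n ! * ∑perm F ys)
        ≡⟨ lemma (n !) m (∑perm F ys) (misses xs) ⟩
      (m + misses xs) * n ! * ∑perm F ys
        ≡⟨ cong (λ k → k * n ! * ∑perm F ys) (trans (length-filter+misses xs) |xs|) ⟩
      suc n ! * ∑perm F ys ∎
      where
      open ≡-Reasoning
      ys = filter P? xs
      m  = length ys
      h : A → List A → ℕ
      h x r = n ! * (m * ∑perm (F ∘ (x ∷_)) r)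
      g : List A → ℕ
      g r = n ! * ∑perm F r

      -- The factor `length ys` makes both sides 0 for the empty list, where `picks` is empty but
      -- `∑perm F []` is `F []`.
      unpick : ∀ ys → length ys * ∑ (picks ys) (λ (x , r) → ∑perm (F ∘ (x ∷_)) r) ≡ length ys * ∑perm F ys
      unpick []       = refl
      unpick (y ∷ ys) = cong (suc (length ys) *_) (∑-cong-∈ (picks (y ∷ ys)) λ {(x , r)} q∈ →
        cong (λ k → ∑sel k (λ p _ → F (x ∷ p)) r)
             (suc-injective (sym (↭-length (picks-↭ (y ∷ ys) q∈)))))

      lemma : ∀ a b c d → a * (b * c) + d * (a * c) ≡ (b + d) * a * c
      lemma = solve-∀

      -- If `x` satisfies `P`, the filtered remainder has length `m - 1`, and `m ! = m * (m - 1) !`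
      -- supplies the factor `m` of `h`; otherwise its length is still `m`.
      step : ∀ {q} → q ∈ picks xs → m ! * ∑sel n (λ p _ → F (filter P? (proj₁ q ∷ p))) (proj₂ q)
        ≡ (if does (P? (proj₁ q)) then h (proj₁ q) (filter P? (proj₂ q)) else g (filter P? (proj₂ q)))
      step {x , r} q∈ with xs↭ ← picks-↭ xs q∈
        with |r| ← suc-injective (trans (sym (↭-length xs↭)) |xs|)
        with m≡ ← ↭-length (filter-↭ P? xs↭)
        with does (P? x)
      ... | true  = begin
        m ! * S                                  ≡⟨ cong (λ k → k ! * S) m≡ ⟩
        suc (length (filter P? r)) * length (filter P? r) ! * S
          ≡⟨ *-assoc (suc (length (filter P? r))) (length (filter P? r) !) S ⟩
        suc (length (filter P? r)) * (length (filter P? r) ! * S)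
          ≡⟨ cong₂ _*_ (sym m≡) (∑perm-filter n (F ∘ (x ∷_)) r |r|) ⟩
        m * (n ! * T)                            ≡⟨ *-swap m (n !) T ⟩
        n ! * (m * T)                            ∎
        where
        S = ∑sel n (λ p _ → F (x ∷ filter P? p)) r
        T = ∑perm (F ∘ (x ∷_)) (filter P? r)
      ... | false = trans (cong (λ k → k ! * _) m≡) (∑perm-filter n F r |r|)

  -- Indicators, filters and fibres.

  𝟙 : {X : Set a} → Dec X → ℕ
  𝟙 X? = if does X? then 1 else 0

  𝟙-mono : {X : Set a} {Y : Set b} (X? : Dec X) (Y? : Dec Y) → (X → Y) → 𝟙 X? ≤ 𝟙 Y?
  𝟙-mono (yes x) (yes y) f = ≤-refl
  𝟙-mono (yes x) (no ¬y) f = contradiction (f x) ¬y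
  𝟙-mono (no ¬x) Y?      f = z≤n

  𝟙≤1 : {X : Set a} (X? : Dec X) → 𝟙 X? ≤ 1
  𝟙≤1 (yes x) = ≤-refl
  𝟙≤1 (no ¬x) = z≤n

  𝟙-no : {X : Set a} (X? : Dec X) → ¬ X → 𝟙 X? ≡ 0
  𝟙-no (yes x) ¬x = contradiction x ¬x
  𝟙-no (no _)  ¬x = refl

  module _ {p q} {P : Pred A p} {Q : Pred A q} (P? : Decidable P) (Q? : Decidable Q) where

    length-filter-mono : ∀ xs → (∀ {x} → x ∈ xs → P x → Q x) →
                         length (filter P? xs) ≤ length (filter Q? xs)
    length-filter-mono []       h = z≤n
    length-filter-mono (x ∷ xs) h with P? x | Q? x
    ... | yes px | yes qx = s≤s (length-filter-mono xs (h ∘ there))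
    ... | yes px | no ¬qx = contradiction (h (here refl) px) ¬qx
    ... | no _   | yes qx = m≤n⇒m≤1+n (length-filter-mono xs (h ∘ there))
    ... | no _   | no _   = length-filter-mono xs (h ∘ there)

    length-filter-strict : ∀ {y} xs → (∀ {x} → x ∈ xs → P x → Q x) → y ∈ xs → ¬ P y → Q y →
                           length (filter P? xs) < length (filter Q? xs)
    length-filter-strict (x ∷ xs) h y∈ ¬py qy with P? x | Q? x
    length-filter-strict (x ∷ xs) h (here refl) ¬py qy | yes px | _      = contradiction px ¬py
    length-filter-strict (x ∷ xs) h (here refl) ¬py qy | no _   | yes _  = s≤s (length-filter-mono xs (h ∘ there))
    length-filter-strict (x ∷ xs) h (here refl) ¬py qy | no _   | no ¬qx = contradiction qy ¬qx
    length-filter-strict (x ∷ xs) h (there y∈)  ¬py qy | yes px | yes _  = s≤s (length-filter-strict xs (h ∘ there) y∈ ¬py qy)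
    length-filter-strict (x ∷ xs) h (there y∈)  ¬py qy | yes px | no ¬qx = contradiction (h (here refl) px) ¬qx
    length-filter-strict (x ∷ xs) h (there y∈)  ¬py qy | no _   | yes _  = m≤n⇒m≤1+n (length-filter-strict xs (h ∘ there) y∈ ¬py qy)
    length-filter-strict (x ∷ xs) h (there y∈)  ¬py qy | no _   | no _   = length-filter-strict xs (h ∘ there) y∈ ¬py qy

  module _ {p q s} {P : Pred A p} {Q : Pred A q} {S : Pred A s}
           (P? : Decidable P) (Q? : Decidable Q) (S? : Decidable S) where

    length-filter-∘ : ∀ xs → (∀ {x} → x ∈ xs → Q x → P x → S x) →
                      length (filter P? (filter Q? xs)) ≤ length (filter S? xs)
    length-filter-∘ []       h = z≤n
    length-filter-∘ (x ∷ xs) h with Q? x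
    ... | no _ = ≤-trans (length-filter-∘ xs (h ∘ there)) (skip S? x xs)
      where
      skip : ∀ (S? : Decidable S) x xs → length (filter S? xs) ≤ length (filter S? (x ∷ xs))
      skip S? x xs with does (S? x)
      ... | true  = n≤1+n _
      ... | false = ≤-refl
    ... | yes qx with P? x | S? x
    ...   | yes px | yes _  = s≤s (length-filter-∘ xs (h ∘ there))
    ...   | yes px | no ¬sx = contradiction (h (here refl) qx px) ¬sx
    ...   | no _   | yes _  = m≤n⇒m≤1+n (length-filter-∘ xs (h ∘ there))
    ...   | no _   | no _   = length-filter-∘ xs (h ∘ there)

  module _ {ℓ} {_≺_ : Rel A ℓ} (_≺?_ : B.Decidable _≺_) (≺-trans : B.Transitive _≺_)
           (≺-irrefl : ∀ {x} → ¬ x ≺ x) where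

    -- Induction, without sorting. If `y` has at most `T` predecessors in `xs`, it takes one of the
    -- `suc T` places, and every other counted `z` has fewer than `T` predecessors in `xs`: above
    -- `y` it loses the predecessor `y`, below `y` it has fewer than `y` has. If `y` has more, it is
    -- not counted, and removing it cannot raise a rank.
    few-least : ∀ T xs → AllPairs (λ x y → x ≺ y ⊎ y ≺ x) xs →
                ∑ xs (λ z → 𝟙 (length (filter (_≺? z) xs) ℕ.<? T)) ≤ T
    few-least T       []       _          = z≤n
    few-least zero    (y ∷ xs) _          =
      ≤-reflexive (trans (∑-const (y ∷ xs) 0) (*-zeroʳ (length (y ∷ xs))))
    few-least (suc T) (y ∷ xs) (y-xs ∷ pw) with length (filter (_≺? y) xs) ℕ.<? suc T
    ... | yes y<T = +-mono-≤ (𝟙≤1 (rank⁺ y ℕ.<? suc T)) (≤-trans (∑-mono xs step) (few-least T xs pw))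
      where
      rank rank⁺ : A → ℕ
      rank  z = length (filter (_≺? z) xs)
      rank⁺ z = length (filter (_≺? z) (y ∷ xs))
      rank<T : ∀ z → z ∈ xs → y ≺ z ⊎ z ≺ y → rank⁺ z < suc T → rank z < T
      rank<T z z∈ (inj₁ y≺z) r<T =
        ≤-pred (subst (_< suc T) (cong length (filter-accept (_≺? z) y≺z)) r<T)
      rank<T z z∈ (inj₂ z≺y) _   = ≤-trans
        (length-filter-strict (_≺? z) (_≺? y) xs (λ _ x≺z → ≺-trans x≺z z≺y) z∈ ≺-irrefl z≺y)
        (≤-pred y<T)
      step : ∀ {z} → z ∈ xs → 𝟙 (rank⁺ z ℕ.<? suc T) ≤ 𝟙 (rank z ℕ.<? T)
      step {z} z∈ = 𝟙-mono (rank⁺ z ℕ.<? suc T) (rank z ℕ.<? T) (rank<T z z∈ (All.lookup y-xs z∈))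
    ... | no y≮T = begin
      𝟙 (rank⁺ y ℕ.<? suc T) + ∑ xs (λ z → 𝟙 (rank⁺ z ℕ.<? suc T))
        ≡⟨ cong (_+ ∑ xs (λ z → 𝟙 (rank⁺ z ℕ.<? suc T)))
             (𝟙-no (rank⁺ y ℕ.<? suc T) λ r<T → y≮T (≤-<-trans (grow y) r<T)) ⟩
      ∑ xs (λ z → 𝟙 (rank⁺ z ℕ.<? suc T))
        ≤⟨ ∑-mono xs (λ {z} _ → 𝟙-mono (rank⁺ z ℕ.<? suc T) (rank z ℕ.<? suc T) (≤-<-trans (grow z))) ⟩
      ∑ xs (λ z → 𝟙 (rank z ℕ.<? suc T))
        ≤⟨ few-least (suc T) xs pw ⟩
      suc T ∎
      where
      open ≤-Reasoning
      rank rank⁺ : A → ℕ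
      rank  z = length (filter (_≺? z) xs)
      rank⁺ z = length (filter (_≺? z) (y ∷ xs))
      grow : ∀ z → rank z ≤ rank⁺ z
      grow z with does (y ≺? z)
      ... | true  = n≤1+n _
      ... | false = ≤-refl

  ∑-delta : ∀ n i c → i < n → ∑ (upTo n) (λ j → if does (i ≟ j) then c else 0) ≡ c
  ∑-delta (suc n) zero    c i<n = trans (∑-upTo-suc n (λ j → if does (0 ≟ j) then c else 0))
    (trans (cong (c +_) (trans (∑-const (upTo n) 0) (*-zeroʳ (length (upTo n))))) (+-identityʳ c))
  ∑-delta (suc n) (suc i) c i<n = trans (∑-upTo-suc n (λ j → if does (suc i ≟ j) then c else 0))
    (∑-delta n i c (≤-pred i<n))

  ∑-fibres : ∀ n (r : A → ℕ) xs g → (∀ {x} → x ∈ xs → r x < n) →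
             ∑ xs g ≡ ∑ (upTo n) (λ j → ∑ (filter (λ x → r x ≟ j) xs) g)
  ∑-fibres n r []       g r<n = sym (trans (∑-const (upTo n) 0) (*-zeroʳ (length (upTo n))))
  ∑-fibres n r (x ∷ xs) g r<n = sym (begin
    ∑ (upTo n) (λ j → ∑ (filter (λ x → r x ≟ j) (x ∷ xs)) g)
      ≡⟨ ∑-cong (upTo n) split ⟩
    ∑ (upTo n) (λ j → (if does (r x ≟ j) then g x else 0) + ∑ (filter (λ x → r x ≟ j) xs) g)
      ≡⟨ ∑-+ (upTo n) (λ j → if does (r x ≟ j) then g x else 0) _ ⟩
    ∑ (upTo n) (λ j → if does (r x ≟ j) then g x else 0) + ∑ (upTo n) (λ j → ∑ (filter (λ x → r x ≟ j) xs) g)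
      ≡⟨ cong₂ _+_ (∑-delta n (r x) (g x) (r<n (here refl))) (sym (∑-fibres n r xs g (r<n ∘ there))) ⟩
    g x + ∑ xs g ∎)
    where
    open ≡-Reasoning
    split : ∀ j → ∑ (filter (λ x → r x ≟ j) (x ∷ xs)) g
                ≡ (if does (r x ≟ j) then g x else 0) + ∑ (filter (λ x → r x ≟ j) xs) g
    split j with does (r x ≟ j)
    ... | true  = refl
    ... | false = refl

  -- The entry j₀ of the sequence f is replaced by two entries, bounded by u and v.
  ∑-split-entry : ∀ n j₀ (f f′ : ℕ → ℕ) u v → j₀ < n → (∀ j → j < j₀ → f′ j ≤ f j) →
    f′ j₀ ≤ u → f′ (suc j₀) ≤ v → (∀ j → j₀ < j → f′ (suc j) ≤ f j) →
    ∑ (upTo (suc n)) f′ ≤ ∑ (upTo n) f + (u + v)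
  ∑-split-entry (suc n) zero f f′ u v _ _ hu hv h> = begin
    ∑ (upTo (2 + n)) f′
      ≡⟨ trans (∑-upTo-suc (suc n) f′) (cong (f′ 0 +_) (∑-upTo-suc n (f′ ∘ suc))) ⟩
    f′ 0 + (f′ 1 + ∑ (upTo n) (λ j → f′ (2 + j)))
      ≤⟨ +-mono-≤ hu (+-mono-≤ hv (∑-mono (upTo n) λ {j} _ → h> (suc j) z<s)) ⟩
    u + (v + ∑ (upTo n) (f ∘ suc))
      ≡⟨ trans (sym (+-assoc u v _)) (+-comm (u + v) _) ⟩
    ∑ (upTo n) (f ∘ suc) + (u + v)
      -- The entry that is replaced stays in the bound, which is harmless for an upper estimate.
      ≤⟨ +-monoˡ-≤ (u + v) (m≤n+m _ (f 0)) ⟩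
    f 0 + ∑ (upTo n) (f ∘ suc) + (u + v)
      ≡⟨ cong (_+ (u + v)) (∑-upTo-suc n f) ⟨
    ∑ (upTo (suc n)) f + (u + v) ∎
    where open ≤-Reasoning
  ∑-split-entry (suc n) (suc j₀) f f′ u v j₀<n h< hu hv h> = begin
    ∑ (upTo (2 + n)) f′
      ≡⟨ ∑-upTo-suc (suc n) f′ ⟩
    f′ 0 + ∑ (upTo (suc n)) (f′ ∘ suc)
      ≤⟨ +-mono-≤ (h< 0 z<s) (∑-split-entry n j₀ (f ∘ suc) (f′ ∘ suc) u v (≤-pred j₀<n)
           (λ j j<j₀ → h< (suc j) (s<s j<j₀)) hu hv (λ j j₀<j → h> (suc j) (s<s j₀<j))) ⟩
    f 0 + (∑ (upTo n) (f ∘ suc) + (u + v))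
      ≡⟨ +-assoc (f 0) _ (u + v) ⟨
    f 0 + ∑ (upTo n) (f ∘ suc) + (u + v)
      ≡⟨ cong (_+ (u + v)) (∑-upTo-suc n f) ⟨
    ∑ (upTo (suc n)) f + (u + v) ∎
    where open ≤-Reasoning

  -- The number of small sections cut out by random separators.

  module SmallSections {c ℓ₁ ℓ₂} (U : StrictTotalOrder c ℓ₁ ℓ₂) where

    open StrictTotalOrder U using (_<?_)
      renaming (Carrier to Key; _<_ to _≺_; trans to ≺-trans; irrefl to ≺-irrefl; asym to ≺-asym)
    open StrictTotalOrder.Eq U using () renaming (refl to ≈-refl)

    Apart : Key → Key → Set ℓ₂
    Apart x y = x ≺ y ⊎ y ≺ x

    Distinct : List Key → Set (c Level.⊔ ℓ₂)
    Distinct = AllPairs Apart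

    Distinct-resp-↭ : ∀ {xs ys} → xs ↭ ys → Distinct xs → Distinct ys
    Distinct-resp-↭ xs↭ys = ↭ₛ.AllPairs-resp-↭ (setoid Key) Sum.swap ((λ { refl → id }) , λ { refl → id }) (↭⇒↭ₛ xs↭ys)

    Distinct-++ʳ : ∀ xs {ys} → Distinct (xs ++ ys) → Distinct ys
    Distinct-++ʳ []       d       = d
    Distinct-++ʳ (x ∷ xs) (_ ∷ d) = Distinct-++ʳ xs d

    rank : List Key → Key → ℕ
    rank q y = length (filter (_<? y) q)

    fibre : (Key → ℕ) → ℕ → List Key → List Key
    fibre r j = filter (λ y → r y ≟ j)

    small : (Key → ℕ) → ℕ → ℕ → List Key → ℕ
    small r n T R = ∑ (upTo n) (λ j → 𝟙 (length (fibre r j R) ℕ.<? T))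

    -- If `z` became a separator, the keys of its section below and above it would form two new
    -- sections; these indicate which of the two is small, that is, whether `z` is among the `T`
    -- least or the `T` greatest keys of its section.
    below above : (Key → ℕ) → ℕ → List Key → Key → ℕ
    below r T R z = 𝟙 (length (filter (_<? z) (fibre r (r z) R)) ℕ.<? T)
    above r T R z = 𝟙 (length (filter (z <?_) (fibre r (r z) R)) ℕ.<? T)

    Distinct-fibre : ∀ r j {R} → Distinct R → Distinct (fibre r j R)
    Distinct-fibre r j d = AllPairs.filter⁺ (λ y → r y ≟ j) d

    -- Within the section of index `j` every `z` has `r z ≡ j`, so `few-least` bounds the
    -- contribution of each section by `T`.
    ∑-below : ∀ r n T R → Distinct R → (∀ {y} → y ∈ R → r y < n) → ∑ R (below r T R) ≤ n * T
    ∑-below r n T R d r<n = begin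
      ∑ R (below r T R)
        ≡⟨ ∑-fibres n r R (below r T R) r<n ⟩
      ∑ (upTo n) (λ j → ∑ (fibre r j R) (below r T R))
        ≤⟨ ∑-mono (upTo n) (λ {j} _ → ≤-trans
             (≤-reflexive (∑-cong-∈ (fibre r j R) λ {z} z∈ →
               cong (λ i → 𝟙 (length (filter (_<? z) (fibre r i R)) ℕ.<? T))
                    (proj₂ (∈-filter⁻ (λ y → r y ≟ j) {xs = R} z∈))))
             (few-least _<?_ ≺-trans (≺-irrefl ≈-refl) T (fibre r j R) (Distinct-fibre r j d))) ⟩
      ∑ (upTo n) (λ _ → T)
        ≡⟨ trans (∑-const (upTo n) T) (cong (_* T) (length-upTo n)) ⟩
      n * T ∎
      where open ≤-Reasoning

    -- `few-least` again, now for the reversed order.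
    ∑-above : ∀ r n T R → Distinct R → (∀ {y} → y ∈ R → r y < n) → ∑ R (above r T R) ≤ n * T
    ∑-above r n T R d r<n = begin
      ∑ R (above r T R)
        ≡⟨ ∑-fibres n r R (above r T R) r<n ⟩
      ∑ (upTo n) (λ j → ∑ (fibre r j R) (above r T R))
        ≤⟨ ∑-mono (upTo n) (λ {j} _ → ≤-trans
             (≤-reflexive (∑-cong-∈ (fibre r j R) λ {z} z∈ →
               cong (λ i → 𝟙 (length (filter (z <?_) (fibre r i R)) ℕ.<? T))
                    (proj₂ (∈-filter⁻ (λ y → r y ≟ j) {xs = R} z∈))))
             (few-least {_≺_ = flip _≺_} (flip _<?_) (flip ≺-trans) (≺-irrefl ≈-refl) T (fibre r j R)
               (AllPairs.map Sum.swap (Distinct-fibre r j d)))) ⟩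
      ∑ (upTo n) (λ _ → T)
        ≡⟨ trans (∑-const (upTo n) T) (cong (_* T) (length-upTo n)) ⟩
      n * T ∎
      where open ≤-Reasoning

    -- The new separator z only affects its own section, which it splits in two.
    small-insert : ∀ (r r′ : Key → ℕ) n T {z R R′} → R ↭ z ∷ R′ → Distinct R → r z < n →
      (∀ {x y} → x ≺ y → r x ≤ r y) →
      (∀ {y} → y ≺ z → r′ y ≡ r y) → (∀ {y} → z ≺ y → r′ y ≡ suc (r y)) →
      small r′ (suc n) T R′ ≤ small r n T R + (below r T R z + above r T R z)
    small-insert r r′ n T {z} {R} {R′} R↭ d rz<n r-mono r′-below r′-above =
      ∑-split-entry n (r z) (λ j → 𝟙 (length (fibre r j R) ℕ.<? T)) (λ j → 𝟙 (length (fibre r′ j R′) ℕ.<? T)) _ _ rz<n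
        -- Sections below that of `z` keep their index, that of `z` yields its two parts at `r z`
        -- and `suc (r z)`, and those above move up by one. Since `𝟙 (length _ <? T)` decreases with
        -- the length, only the inequality from old to new length has to be shown.
        (λ j j<rz → bound j (fibre r j R) (≤-trans (via j (λ eq → <⇒≢ j<rz (sym eq)))
          (length-filter-mono (λ y → r y ≟ j) (λ y → r′ y ≟ j) R′ λ {y} y∈ eq → side-< j<rz eq (apart y∈))))
        (bound (r z) (filter (_<? z) (fibre r (r z) R)) (≤-trans (∘-via (_<? z) (r z) (≺-irrefl ≈-refl))
          (length-filter-∘ (_<? z) (λ y → r y ≟ r z) (λ y → r′ y ≟ r z) R′ λ _ eq y≺z → trans (r′-below y≺z) eq)))
        (bound (suc (r z)) (filter (z <?_) (fibre r (r z) R)) (≤-trans (∘-via (z <?_) (r z) (≺-irrefl ≈-refl))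
          (length-filter-∘ (z <?_) (λ y → r y ≟ r z) (λ y → r′ y ≟ suc (r z)) R′ λ _ eq z≺y → trans (r′-above z≺y) (cong suc eq))))
        (λ j rz<j → bound (suc j) (fibre r j R) (≤-trans (via j (<⇒≢ rz<j))
          (length-filter-mono (λ y → r y ≟ j) (λ y → r′ y ≟ suc j) R′ λ {y} y∈ eq → side-> rz<j eq (apart y∈))))
      where
      bound : ∀ j (S : List Key) → length S ≤ length (fibre r′ j R′) →
              𝟙 (length (fibre r′ j R′) ℕ.<? T) ≤ 𝟙 (length S ℕ.<? T)
      bound j S le = 𝟙-mono (length (fibre r′ j R′) ℕ.<? T) (length S ℕ.<? T) (≤-<-trans le)

      via : ∀ j → r z ≢ j → length (fibre r j R) ≤ length (fibre r j R′)
      via j rz≢j = ≤-reflexive (trans (↭-length (filter-↭ (λ y → r y ≟ j) R↭))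
        (cong length (filter-reject (λ y → r y ≟ j) rz≢j)))

      ∘-via : ∀ {ℓ} {P : Pred Key ℓ} (P? : Decidable P) j → ¬ P z →
              length (filter P? (fibre r j R)) ≤ length (filter P? (fibre r j R′))
      ∘-via P? j ¬Pz = ≤-trans (≤-reflexive (↭-length (filter-↭ P? (filter-↭ (λ y → r y ≟ j) R↭)))) drop-z
        where
        drop-z : length (filter P? (fibre r j (z ∷ R′))) ≤ length (filter P? (fibre r j R′))
        drop-z with does (r z ≟ j)
        ... | false = ≤-refl
        ... | true  = ≤-reflexive (cong length (filter-reject P? ¬Pz))

      apart : ∀ {y} → y ∈ R′ → Apart z y
      apart y∈ with Distinct-resp-↭ R↭ d
      ... | z-R′ ∷ _ = All.lookup z-R′ y∈

      side-< : ∀ {j y} → j < r z → r y ≡ j → Apart z y → r′ y ≡ j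
      side-< j<rz eq (inj₁ z≺y) = contradiction (≤-trans (r-mono z≺y) (≤-reflexive eq)) (<⇒≱ j<rz)
      side-< j<rz eq (inj₂ y≺z) = trans (r′-below y≺z) eq

      side-> : ∀ {j y} → r z < j → r y ≡ j → Apart z y → r′ y ≡ suc j
      side-> rz<j eq (inj₁ z≺y) = trans (r′-above z≺y) (cong suc eq)
      side-> rz<j eq (inj₂ y≺z) = contradiction (≤-trans (≤-reflexive (sym eq)) (r-mono y≺z)) (<⇒≱ rz<j)

    -- The sections cut out of R by the separators q that have fewer than T keys.
    smallSections : ℕ → List Key → List Key → ℕ
    smallSections T q R = small (rank q) (suc (length q)) T R

    -- Appending `z` adds 1 to the rank of the keys above `z` and nothing to those below, as
    -- `small-insert` requires.
    smallSections-∷ʳ : ∀ T q {z R R′} → R ↭ z ∷ R′ → Distinct R →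
      smallSections T (q ∷ʳ z) R′ ≤ smallSections T q R + (below (rank q) T R z + above (rank q) T R z)
    smallSections-∷ʳ T q {z} {R} {R′} R↭ d =
      subst (λ n → small (rank (q ∷ʳ z)) n T R′ ≤ smallSections T q R + (below (rank q) T R z + above (rank q) T R z))
        (cong suc (sym (trans (length-++ q) (+-comm (length q) 1))))
        (small-insert (rank q) (rank (q ∷ʳ z)) (suc (length q)) T R↭ d (s≤s (length-filter (_<? z) q))
          (λ {x} {y} x≺y → length-filter-mono (_<? x) (_<? y) q (λ _ w≺x → ≺-trans w≺x x≺y))
          (λ {y} y≺z → trans (rank-∷ʳ y) (trans (cong (λ l → rank q y + length l) (filter-reject (_<? y) (≺-asym y≺z))) (+-identityʳ _)))
          (λ {y} z≺y → trans (rank-∷ʳ y) (trans (cong (λ l → rank q y + length l) (filter-accept (_<? y) z≺y)) (+-comm _ 1))))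
      where
      rank-∷ʳ : ∀ y → rank (q ∷ʳ z) y ≡ rank q y + rank [ z ] y
      rank-∷ʳ y = trans (cong length (filter-++ (_<? y) q [ z ])) (length-++ (filter (_<? y) q))

    -- Each of the at most k sections at hand contains at most 2T keys whose
    -- choice as a separator creates a small section, among at least m keys.
    few-small : ∀ T k m i q R → Distinct R → length q + i ≤ k → m + i ≤ length R →
      m * ∑sel i (λ p r → smallSections T (q ++ p) r) R
      ≤ fall (length R) i * (m * smallSections T q R + i * (2 * T * k))
    few-small T k m zero    q R d _ _ rewrite ++-identityʳ q =
      ≤-reflexive (trans (sym (+-identityʳ _)) (sym (*-identityˡ _)))
    few-small T k m (suc i) q R d q≤k m≤R = begin
      m * ∑ (picks R) (λ (z , r) → ∑sel i (λ p r′ → N (q ++ z ∷ p) r′) r)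
        ≡⟨ ∑-* m (picks R) (λ (z , r) → ∑sel i (λ p r′ → N (q ++ z ∷ p) r′) r) ⟨
      ∑ (picks R) (λ (z , r) → m * ∑sel i (λ p r′ → N (q ++ z ∷ p) r′) r)
        ≤⟨ ∑-mono (picks R) step ⟩
      ∑ (picks R) (λ (z , r) → F * (m * (N q R + g z) + i * C))
        ≡⟨ ∑-picks-proj₁ R (λ z → F * (m * (N q R + g z) + i * C)) ⟩
      ∑ R (λ z → F * (m * (N q R + g z) + i * C))
        ≡⟨ ∑-* F R (λ z → m * (N q R + g z) + i * C) ⟩
      F * ∑ R (λ z → m * (N q R + g z) + i * C)
        ≡⟨ cong (F *_) (trans (∑-+ R (λ z → m * (N q R + g z)) (λ _ → i * C)) (cong₂ _+_
             (trans (∑-* m R (λ z → N q R + g z)) (cong (m *_) (trans (∑-+ R (λ _ → N q R) g) (cong (_+ ∑ R g) (∑-const R (N q R))))))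
             (∑-const R (i * C)))) ⟩
      F * (m * (length R * N q R + ∑ R g) + length R * (i * C))
        ≤⟨ *-monoʳ-≤ F (+-monoˡ-≤ (length R * (i * C)) (*-monoʳ-≤ m (+-monoʳ-≤ (length R * N q R) ∑g))) ⟩
      F * (m * (length R * N q R + C) + length R * (i * C))
        -- The new small sections cost `m * C` in total; `m ≤ length R` enlarges this to
        -- `length R * C`, so that `length R` factors out and completes `F` to
        -- `fall (length R) (suc i)`.
        ≤⟨ *-monoʳ-≤ F (+-monoˡ-≤ (length R * (i * C)) (≤-trans (≤-reflexive (*-distribˡ-+ m (length R * N q R) C))
             (+-monoʳ-≤ (m * (length R * N q R)) (*-monoˡ-≤ C (m+n≤o⇒m≤o m m≤R))))) ⟩
      F * (m * (length R * N q R) + length R * C + length R * (i * C))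
        ≡⟨ lemma F m (length R) (N q R) C i ⟩
      length R * F * (m * N q R + suc i * C) ∎
      where
      open ≤-Reasoning
      N = smallSections T
      C = 2 * T * k
      F = fall (pred (length R)) i
      g : Key → ℕ
      g z = below (rank q) T R z + above (rank q) T R z

      lemma : ∀ F m l n C i → F * (m * (l * n) + l * C + l * (i * C)) ≡ l * F * (m * n + (C + i * C))
      lemma = solve-∀

      rank< : ∀ {y} → y ∈ R → rank q y < suc (length q)
      rank< {y} _ = s≤s (length-filter (_<? y) q)

      ∑g : ∑ R g ≤ C
      ∑g = begin
        ∑ R g                                          ≡⟨ ∑-+ R (below (rank q) T R) (above (rank q) T R) ⟩
        ∑ R (below (rank q) T R) + ∑ R (above (rank q) T R)
          ≤⟨ +-mono-≤ (∑-below (rank q) (suc (length q)) T R d rank<) (∑-above (rank q) (suc (length q)) T R d rank<) ⟩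
        suc (length q) * T + suc (length q) * T        ≡⟨ double (suc (length q)) T ⟩
        -- A separator is still to be drawn, so there are at most `k` sections now, although `k`
        -- separators give `suc k` in the end.
        2 * T * suc (length q)                         ≤⟨ *-monoʳ-≤ (2 * T) (≤-trans (s≤s (m≤m+n (length q) i)) (≤-trans (≤-reflexive (sym (+-suc (length q) i))) q≤k)) ⟩
        2 * T * k                                      ∎
        where
        double : ∀ a b → a * b + a * b ≡ 2 * b * a
        double = solve-∀

      step : ∀ {x} → x ∈ picks R →
             m * ∑sel i (λ p r′ → N (q ++ proj₁ x ∷ p) r′) (proj₂ x) ≤ F * (m * (N q R + g (proj₁ x)) + i * C)
      step {z , r} x∈ = begin
        m * ∑sel i (λ p r′ → N (q ++ z ∷ p) r′) r
          ≡⟨ cong (m *_) (∑sel-cong i r λ p r′ _ → cong (λ l → N l r′) (sym (∷ʳ-++ q z p))) ⟩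
        m * ∑sel i (λ p r′ → N (q ∷ʳ z ++ p) r′) r
          ≤⟨ few-small T k m i (q ∷ʳ z) r (Distinct-++ʳ [ z ] (Distinct-resp-↭ R↭ d))
               (≤-trans (≤-reflexive (trans (cong (_+ i) (trans (length-++ q) (+-comm (length q) 1))) (sym (+-suc (length q) i)))) q≤k)
               (≤-pred (≤-trans (≤-reflexive (sym (+-suc m i))) (≤-trans m≤R (≤-reflexive (↭-length R↭))))) ⟩
        fall (length r) i * (m * N (q ∷ʳ z) r + i * C)
          ≡⟨ cong (λ l → fall (pred l) i * (m * N (q ∷ʳ z) r + i * C)) (sym (↭-length R↭)) ⟩
        F * (m * N (q ∷ʳ z) r + i * C)
          ≤⟨ *-monoʳ-≤ F (+-monoˡ-≤ (i * C) (*-monoʳ-≤ m (smallSections-∷ʳ T q R↭ d))) ⟩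
        F * (m * (N q R + g z) + i * C) ∎
        where R↭ = picks-↭ R x∈

    -- Without separators there is one section, `R` itself, and it is not small. Each of the `k`
    -- draws then creates on average at most `2 * T * k / m` small sections, which is at most 1/2.
    half-small : ∀ T k m R → .{{NonZero m}} → Distinct R → m + k ≤ length R → T ≤ length R → 4 * T * k ≤ m →
      2 * ∑sel k (smallSections T) R ≤ fall (length R) k * k
    half-small T k m R d mk≤R T≤R 4Tk≤m = *-cancelˡ-≤ m (begin
      m * (2 * ∑sel k (smallSections T) R)
        ≡⟨ *-swap m 2 _ ⟩
      2 * (m * ∑sel k (smallSections T) R)
        ≤⟨ *-monoʳ-≤ 2 (few-small T k m k [] R d ≤-refl mk≤R) ⟩
      2 * (F * (m * smallSections T [] R + k * (2 * T * k)))
        ≡⟨ cong (λ s → 2 * (F * (m * s + k * (2 * T * k)))) none-small ⟩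
      2 * (F * (m * 0 + k * (2 * T * k)))
        ≡⟨ lemma F m k T ⟩
      F * k * (4 * T * k)
        ≤⟨ *-monoʳ-≤ (F * k) 4Tk≤m ⟩
      F * k * m
        ≡⟨ *-comm (F * k) m ⟩
      m * (F * k) ∎)
      where
      open ≤-Reasoning
      F = fall (length R) k
      lemma : ∀ F m k T → 2 * (F * (m * 0 + k * (2 * T * k))) ≡ F * k * (4 * T * k)
      lemma = solve-∀
      none-small : smallSections T [] R ≡ 0
      none-small = trans (+-identityʳ _) (𝟙-no (length (fibre (rank []) 0 R) ℕ.<? T) λ lt →
        <⇒≱ lt (≤-trans T≤R (≤-reflexive (cong length (sym (filter-all (λ y → 0 ≟ 0) (All.universal (λ _ → refl) R)))))))

    -- Removing `p` takes at most `length p` keys from a section, so a section that is small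
    -- afterwards was small before for the larger threshold.
    smallSections-++ : ∀ T q p {R R′} → R ↭ p ++ R′ → smallSections T q R′ ≤ smallSections (T + length p) q R
    smallSections-++ T q p {R} {R′} R↭ = ∑-mono (upTo (suc (length q))) λ {j} _ →
      𝟙-mono (length (fibre (rank q) j R′) ℕ.<? T) (length (fibre (rank q) j R) ℕ.<? T + length p) λ lt → begin-strict
        length (fibre (rank q) j R)                                     ≡⟨ ↭-length (filter-↭ (λ y → rank q y ≟ j) R↭) ⟩
        length (fibre (rank q) j (p ++ R′))                             ≡⟨ cong length (filter-++ (λ y → rank q y ≟ j) p R′) ⟩
        length (fibre (rank q) j p ++ fibre (rank q) j R′)              ≡⟨ length-++ (fibre (rank q) j p) ⟩
        length (fibre (rank q) j p) + length (fibre (rank q) j R′)      ≤⟨ +-monoˡ-≤ _ (length-filter (λ y → rank q y ≟ j) p) ⟩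
        length p + length (fibre (rank q) j R′)                         <⟨ +-monoʳ-< (length p) lt ⟩
        length p + T                                                    ≡⟨ +-comm (length p) T ⟩
        T + length p                                                    ∎
      where open ≤-Reasoning

  -- Division, prefixes and falling factorials.

  m<[1+m/n]*n : ∀ m n .{{_ : NonZero n}} → m < suc (m / n) * n
  m<[1+m/n]*n m n = ≤-trans (≤-reflexive (cong suc (m≡m%n+[m/n]*n m n))) (+-monoˡ-< (m / n * n) (m%n<n m n))

  𝟙-elim : ∀ {x c} {X : Set x} (C : ℕ → Set c) (X? : Dec X) → (X → C 1) → (¬ X → C 0) → C (𝟙 X?)
  𝟙-elim C (yes x) c₁ c₀ = c₁ x
  𝟙-elim C (no ¬x) c₁ c₀ = c₀ ¬x

  take-++-≤ : ∀ k (xs ys : List A) → k ≤ length xs → take k (xs ++ ys) ≡ take k xs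
  take-++-≤ zero    xs       ys _  = refl
  take-++-≤ (suc k) (x ∷ xs) ys le = cong (x ∷_) (take-++-≤ k xs ys (≤-pred le))

  take-++-≡ : ∀ {k} (xs ys : List A) → length xs ≡ k → take k (xs ++ ys) ≡ xs
  take-++-≡ xs ys refl = trans (take-++-≤ (length xs) xs ys ≤-refl) (take-all (length xs) xs ≤-refl)

  drop-++-≡ : ∀ {k} (xs ys : List A) → length xs ≡ k → drop k (xs ++ ys) ≡ ys
  drop-++-≡ []       ys refl = refl
  drop-++-≡ (x ∷ xs) ys refl = drop-++-≡ xs ys refl

  length-rest : ∀ {k m xs} (p : List A) {r} → length p ≡ k → length xs ≡ k + m → xs ↭ p ++ r → length r ≡ m
  length-rest {k = k} p {r = r} |p| |xs| xs↭ = +-cancelˡ-≡ k _ _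
    (trans (cong (_+ length r) (sym |p|)) (trans (sym (length-++ p)) (trans (sym (↭-length xs↭)) |xs|)))

  fall-+ : ∀ k e s → fall (k + s) (k + e) ≡ fall (k + s) k * fall s e
  fall-+ zero    e s = sym (*-identityˡ _)
  fall-+ (suc k) e s = trans (cong (suc (k + s) *_) (fall-+ k e s)) (sym (*-assoc (suc (k + s)) (fall (k + s) k) (fall s e)))

  fall-self : ∀ n → fall n n ≡ n !
  fall-self zero    = refl
  fall-self (suc n) = cong (suc n *_) (fall-self n)

  -- The potential of a subtree.

  module Potential (α β c : ℕ) where

    -- With a = α + 1 and ρ = β / a, these are β max (1 , c s / ρ - 1) and
    -- α β (s / α + max (1 , c s / ρ - 1)).
    ψ Φ : ℕ → ℕ
    ψ s = β ⊔ (c * (suc α * s) ∸ β)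
    Φ s = s * β + α * ψ s

    β≤ψ : ∀ s → β ≤ ψ s
    β≤ψ s = m≤m⊔n β _

    ψ-mono : ∀ {s t} → s ≤ t → ψ s ≤ ψ t
    ψ-mono s≤t = ⊔-monoʳ-≤ β (∸-monoˡ-≤ β (*-monoʳ-≤ c (*-monoʳ-≤ (suc α) s≤t)))

    module _ .{{_ : NonZero α}} (12≤c : 12 ≤ c) (large : 2 * c * (α * suc α) ≤ β) where

      -- ρ / 4, rounded down.
      T : ℕ
      T = β / (4 * suc α)

      -- Since ρ is at least `2 * c * α`, a quarter of it exceeds `α`; hence `T ∸ α` is a genuine
      -- difference.
      α≤T : α ≤ T
      α≤T = ≮⇒≥ λ T<α → <-irrefl refl (begin-strict
        β                            <⟨ m<[1+m/n]*n β (4 * suc α) ⟩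
        suc T * (4 * suc α)          ≤⟨ *-monoˡ-≤ (4 * suc α) T<α ⟩
        α * (4 * suc α)              ≡⟨ lemma α (suc α) ⟩
        4 * (α * suc α)              ≤⟨ *-monoˡ-≤ (α * suc α) (≤-trans (m≤m+n 4 20) (*-monoʳ-≤ 2 12≤c)) ⟩
        2 * c * (α * suc α)          ≤⟨ large ⟩
        β                            ∎)
        where
        open ≤-Reasoning
        lemma : ∀ a b → a * (4 * b) ≡ 4 * (a * b)
        lemma = solve-∀

      -- From `β < suc T * (4 * suc α)` and `suc T ≤ M + (α + α)` follows
      -- `c * β ≤ 4 * (c * (suc α * M)) + 4 * β`, the last term by `large`. So 12 is 4 · 2 for the
      -- claim plus 4 for this loss.
      large-section : ∀ M → T ≤ M + α → 2 * β ≤ c * (suc α * M)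
      large-section M T≤ = *-cancelˡ-≤ 4 (+-cancelʳ-≤ (4 * β) _ _ (begin
        4 * (2 * β) + 4 * β                         ≡⟨ lemma₁ β ⟩
        12 * β                                      ≤⟨ *-monoˡ-≤ β 12≤c ⟩
        c * β                                       ≤⟨ *-monoʳ-≤ c (<⇒≤ (m<[1+m/n]*n β (4 * suc α))) ⟩
        c * (suc T * (4 * suc α))                   ≤⟨ *-monoʳ-≤ c (*-monoˡ-≤ (4 * suc α) (s≤s T≤)) ⟩
        c * (suc (M + α) * (4 * suc α))             ≤⟨ *-monoʳ-≤ c (*-monoˡ-≤ (4 * suc α) (≤-trans (≤-reflexive (sym (+-suc M α))) (+-monoʳ-≤ M (+-monoˡ-≤ α (>-nonZero⁻¹ α))))) ⟩
        c * ((M + (α + α)) * (4 * suc α))           ≡⟨ lemma₂ c M α (suc α) ⟩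
        4 * (c * (suc α * M)) + 4 * (2 * c * (α * suc α)) ≤⟨ +-monoʳ-≤ (4 * (c * (suc α * M))) (*-monoʳ-≤ 4 large) ⟩
        4 * (c * (suc α * M)) + 4 * β               ∎))
        where
        open ≤-Reasoning
        lemma₁ : ∀ b → 4 * (2 * b) + 4 * b ≡ 12 * b
        lemma₁ = solve-∀
        lemma₂ : ∀ c M a b → c * ((M + (a + a)) * (4 * b)) ≡ 4 * (c * (b * M)) + 4 * (2 * c * (a * b))
        lemma₂ = solve-∀

      -- A linear bound for the maximum in `ψ`: a section that is not small has
      -- `2 * β ≤ c * (suc α * M)`, so both branches are covered; a small one is granted `2 * β`
      -- extra.
      ψ-section : ∀ M → ψ M + β ≤ c * (suc α * M) + 2 * β * 𝟙 (M ℕ.<? T ∸ α)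
      ψ-section M = ≤-trans (≤-reflexive (+-distribʳ-⊔ β β _)) (⊔-lub ββ (≤-trans (≤-reflexive (+-comm (X ∸ β) β)) βX))
        where
        open ≤-Reasoning
        X = c * (suc α * M)
        ββ : β + β ≤ X + 2 * β * 𝟙 (M ℕ.<? T ∸ α)
        ββ = 𝟙-elim (λ i → β + β ≤ X + 2 * β * i) (M ℕ.<? T ∸ α)
          (λ _ → ≤-trans (≤-reflexive (trans (cong (β +_) (sym (+-identityʳ β))) (sym (*-identityʳ (2 * β))))) (m≤n+m _ X))
          (λ M≮ → ≤-trans (≤-reflexive (cong (β +_) (sym (+-identityʳ β)))) (≤-trans
            (large-section M (≤-trans (m≤n+m∸n T α) (≤-trans (+-monoʳ-≤ α (≮⇒≥ M≮)) (≤-reflexive (+-comm α M))))) (m≤m+n X _)))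
        βX : β + (X ∸ β) ≤ X + 2 * β * 𝟙 (M ℕ.<? T ∸ α)
        βX with ≤-total β X
        ... | inj₁ β≤X = ≤-trans (≤-reflexive (m+[n∸m]≡n β≤X)) (m≤m+n X _)
        ... | inj₂ X≤β = ≤-trans (≤-reflexive (trans (cong (β +_) (m≤n⇒m∸n≡0 X≤β)) (+-identityʳ β))) (≤-trans (m≤m+n β β) ββ)

  -- The number of blocks as a recursion on lists of keys.

  module Size {c ℓ₁ ℓ₂} (U : StrictTotalOrder c ℓ₁ ℓ₂)
              (α : ℕ) .{{_ : NonZero α}} (ε : ℚ) .{{_ : Positive ε}} where

    open StrictTotalOrder U using () renaming (Carrier to Key)
    open SmallSections U using (Distinct; Distinct-resp-↭; Distinct-++ʳ; Distinct-fibre; smallSections; smallSections-++; half-small)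
    open RBST U α ε using (build; section; section-shrinks; rank)

    blockCount : List Key → ℕ
    blockCount Y = maybe′ blocks 0 (build Y (<-wellFounded _))

    -- The recursive calls carry accessibility proofs obtained from that of the parent; this lets
    -- them be rewritten as `blockCount`, which uses `<-wellFounded`.
    build-irrelevant : ∀ Y a b → build Y a ≡ build Y b
    build-irrelevant []       _          _           = refl
    build-irrelevant (y ∷ ys) (acc rec) (acc rec′) =
      cong (λ ts → just (if does (length (y ∷ ys) ≤? α) then block (y ∷ ys) [] [] else block (take α (y ∷ ys)) separators ts))
        (mapMaybe-cong (λ j → build-irrelevant _ (rec (section-shrinks separators y ys j)) (rec′ (section-shrinks separators y ys j)))
          (upTo (δ α ε (length (y ∷ ys)))))
      where separators = take (δ α ε (length (y ∷ ys)) ∸ 1) (y ∷ ys)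

    blocksForest-mapMaybe : ∀ {X : Set} (f : X → Maybe (Tree Key)) js →
      blocksForest (mapMaybe f js) ≡ ∑ js (maybe′ blocks 0 ∘ f)
    blocksForest-mapMaybe f []       = refl
    blocksForest-mapMaybe f (j ∷ js) with f j
    ... | just t  = cong (blocks t +_) (blocksForest-mapMaybe f js)
    ... | nothing = blocksForest-mapMaybe f js

    blocks-single : ∀ Y a → length Y ≤ α → maybe′ blocks 0 (build Y a) ≤ 1
    blocks-single []       _         _  = z≤n
    blocks-single (y ∷ ys) (acc rec) le =
      ≤-reflexive (single (dec-true (length (y ∷ ys) ≤? α) le))
      where
      single : ∀ {b ks ss ts} → b ≡ true → blocks (if b then block (y ∷ ys) [] [] else block ks ss ts) ≡ 1
      single refl = refl

    blocks-split : ∀ Y a → α < length Y →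
      maybe′ blocks 0 (build Y a) ≡ suc (∑ (upTo (δ α ε (length Y)))
        (λ j → blockCount (section (take (δ α ε (length Y) ∸ 1) Y) (drop α Y) j)))
    blocks-split Y@(y ∷ ys) (acc rec) lt = trans
      (cong (λ b → blocks (if b then block Y [] [] else block (take α Y) separators (mapMaybe child js)))
            (dec-false (length Y ≤? α) (<⇒≱ lt)))
      (cong suc (trans (blocksForest-mapMaybe child js)
        (∑-cong js λ j → cong (maybe′ blocks 0)
          (build-irrelevant (section separators (drop α Y) j) (rec (section-shrinks separators y ys j)) (<-wellFounded _)))))
      where
      js         = upTo (δ α ε (length Y))
      separators = take (δ α ε (length Y) ∸ 1) Y
      child : ℕ → Maybe (Tree Key)
      child j = build (section separators (drop α Y) j) (rec (section-shrinks separators y ys j))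

    -- Induction on the number of keys, from two facts about the fan-out.

    module _ (β c : ℕ) (12≤c : 12 ≤ c) (large : 2 * c * (α * suc α) ≤ β)
             (δ-suc : ∀ s → ∃ λ k → δ α ε s ≡ suc k × k ≤ α)
             (δ-bound : ∀ m k → δ α ε (α + m) ≡ 2 + k → suc k * β < suc α * m) where

      open Potential α β c

      ∑-length-section : ∀ k p r → length p ≡ k → ∑ (upTo (suc k)) (λ j → length (section p r j)) ≡ length r
      ∑-length-section k p r refl = sym (trans
        (trans (sym (trans (∑-const r 1) (*-identityʳ _)))
               (∑-fibres (suc k) (rank p) r (λ _ → 1) (λ {y} _ → s≤s (length-filter _ p))))
        (∑-cong (upTo (suc k)) λ j → trans (∑-const (section p r j) 1) (*-identityʳ _)))

      ∑ψ-sections : ∀ k p r → length p ≡ k →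
        ∑ (upTo (suc k)) (λ j → ψ (length (section p r j))) + suc k * β
        ≤ c * (suc α * length r) + 2 * β * smallSections (T 12≤c large ∸ α) p r
      ∑ψ-sections k p r refl = begin
        ∑ js (λ j → ψ (M j)) + suc k * β
          ≡⟨ cong (∑ js (λ j → ψ (M j)) +_) (trans (∑-const js β) (cong (_* β) (length-upTo (suc k)))) ⟨
        ∑ js (λ j → ψ (M j)) + ∑ js (λ _ → β)
          ≡⟨ ∑-+ js (λ j → ψ (M j)) (λ _ → β) ⟨
        ∑ js (λ j → ψ (M j) + β)
          ≤⟨ ∑-mono js (λ {j} _ → ψ-section 12≤c large (M j)) ⟩
        ∑ js (λ j → c * (suc α * M j) + 2 * β * S j)
          ≡⟨ ∑-+ js (λ j → c * (suc α * M j)) (λ j → 2 * β * S j) ⟩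
        ∑ js (λ j → c * (suc α * M j)) + ∑ js (λ j → 2 * β * S j)
          ≡⟨ cong₂ _+_ (trans (∑-* c js (λ j → suc α * M j)) (cong (c *_) (trans (∑-* (suc α) js M) (cong (suc α *_) (∑-length-section k p r refl)))))
                       (∑-* (2 * β) js S) ⟩
        c * (suc α * length r) + 2 * β * smallSections (T 12≤c large ∸ α) p r ∎
        where
        open ≤-Reasoning
        js = upTo (suc k)
        M S : ℕ → ℕ
        M j = length (section p r j)
        S j = 𝟙 (M j ℕ.<? T 12≤c large ∸ α)

      -- Only the first `k` keys of the root are separators; the other `e` may remove keys from the
      -- sections. Raising the threshold from `T₁` to `T₁ + e`, still at most ρ / 4, makes the count
      -- independent of these `e` keys, and `half-small` applies to the first `k` draws.
      ∑sel-smallSections : ∀ k e m L → .{{NonZero k}} → Distinct L → k + e ≡ α → length L ≡ α + m → k * β < suc α * m →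
        2 * ∑sel α (λ p r → smallSections (T 12≤c large ∸ α) (take k p) r) L ≤ fall (α + m) α * k
      ∑sel-smallSections k e m L d refl |L| kβ< = begin
        2 * ∑sel (k + e) (λ p r → smallSections T₁ (take k p) r) L
          ≡⟨ cong (2 *_) (∑sel-∘ k e (λ p r → smallSections T₁ (take k p) r) L) ⟩
        2 * ∑sel k (λ q → ∑sel e (λ p r → smallSections T₁ (take k (q ++ p)) r)) L
          ≤⟨ *-monoʳ-≤ 2 (∑sel-mono k L inner) ⟩
        2 * ∑sel k (λ q r → fall (e + m) e * smallSections T₂ q r) L
          ≡⟨ cong (2 *_) (∑sel-* k (fall (e + m) e) (smallSections T₂) L) ⟩
        2 * (fall (e + m) e * ∑sel k (smallSections T₂) L)
          ≡⟨ *-swap 2 (fall (e + m) e) _ ⟩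
        fall (e + m) e * (2 * ∑sel k (smallSections T₂) L)
          ≤⟨ *-monoʳ-≤ (fall (e + m) e) (half-small T₂ k m L {{>-nonZero (≤-trans (s≤s z≤n) 0<m)}} d
               (≤-trans (≤-reflexive (+-comm m k)) (≤-trans (+-monoˡ-≤ m (m≤m+n k e)) (≤-reflexive (sym |L|))))
               (≤-trans (m≤m*n T₂ (4 * k) {{m*n≢0 4 k}}) (≤-trans (≤-reflexive (rot T₂ k)) (≤-trans 4Tk≤m (≤-trans (m≤n+m m (k + e)) (≤-reflexive (sym |L|))))))
               4Tk≤m) ⟩
        fall (e + m) e * (fall (length L) k * k)
          ≡⟨ cong (λ l → fall (e + m) e * (fall l k * k)) (trans |L| (+-assoc k e m)) ⟩
        fall (e + m) e * (fall (k + (e + m)) k * k)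
          ≡⟨ rot′ (fall (e + m) e) (fall (k + (e + m)) k) k ⟩
        fall (k + (e + m)) k * fall (e + m) e * k
          ≡⟨ cong (_* k) (sym (fall-+ k e (e + m))) ⟩
        fall (k + (e + m)) (k + e) * k
          ≡⟨ cong (λ l → fall l (k + e) * k) (sym (+-assoc k e m)) ⟩
        fall (k + e + m) (k + e) * k ∎
        where
        open ≤-Reasoning
        T₁ = T 12≤c large ∸ α
        T₂ = T₁ + e

        rot : ∀ a b → a * (4 * b) ≡ 4 * a * b
        rot = solve-∀
        rot′ : ∀ a b c → a * (b * c) ≡ b * a * c
        rot′ = solve-∀

        0<m : 0 < m
        0<m = ≰⇒> λ { z≤n → <⇒≱ kβ< (≤-trans (≤-reflexive (*-zeroʳ (suc α))) z≤n) }

        T₂≤T : T₂ ≤ T 12≤c large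
        T₂≤T = ≤-trans (+-monoʳ-≤ T₁ (m≤n+m e k)) (≤-reflexive (m∸n+n≡m (α≤T 12≤c large)))

        -- The threshold is at most ρ / 4 and more than `k * ρ` keys lie below the root: this is
        -- where the fan-out rule enters.
        4Tk≤m : 4 * T₂ * k ≤ m
        4Tk≤m = *-cancelˡ-≤ (suc α) (begin
          suc α * (4 * T₂ * k)      ≡⟨ shuffle (suc α) T₂ k ⟩
          k * (T₂ * (4 * suc α))    ≤⟨ *-monoʳ-≤ k (≤-trans (*-monoˡ-≤ (4 * suc α) T₂≤T) (m/n*n≤m β (4 * suc α))) ⟩
          k * β                     ≤⟨ <⇒≤ kβ< ⟩
          suc α * m                 ∎)
          where
          shuffle : ∀ a t k → a * (4 * t * k) ≡ k * (t * (4 * a))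
          shuffle = solve-∀

        inner : ∀ q r → length q ≡ k → L ↭ q ++ r →
          ∑sel e (λ p r′ → smallSections T₁ (take k (q ++ p)) r′) r ≤ fall (e + m) e * smallSections T₂ q r
        inner q r |q| L↭ = begin
          ∑sel e (λ p r′ → smallSections T₁ (take k (q ++ p)) r′) r
            ≤⟨ ∑sel-mono e r (λ p r′ |p| r↭ → subst₂ (λ q′ t → smallSections T₁ q′ r′ ≤ smallSections (T₁ + t) q r)
                 (sym (take-++-≡ q p |q|)) |p| (smallSections-++ T₁ q p r↭)) ⟩
          ∑sel e (λ _ _ → smallSections T₂ q r) r
            ≡⟨ ∑sel-const e _ r ⟩
          fall (length r) e * smallSections T₂ q r
            ≡⟨ cong (λ l → fall l e * smallSections T₂ q r) |r| ⟩
          fall (e + m) e * smallSections T₂ q r ∎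
          where
          |r| : length r ≡ e + m
          |r| = length-rest q |q| (trans |L| (+-assoc k e m)) L↭

      -- For `k = 0` there is one section, which may well be small, and monotonicity of `ψ`
      -- suffices. Otherwise the last hypothesis, supplied by `δ-bound`, provides enough keys for
      -- the average in `∑sel-smallSections`.
      ∑sel-ψ : ∀ k m L → Distinct L → k ≤ α → length L ≡ α + m → (∀ k′ → k ≡ suc k′ → k * β < suc α * m) →
        ∑sel α (λ p r → ∑ (upTo (suc k)) (λ j → ψ (length (section (take k p) r j)))) L ≤ fall (α + m) α * ψ (α + m)
      ∑sel-ψ zero m L d k≤α |L| kβ< = begin
        ∑sel α (λ p r → ψ (length (section [] r 0)) + 0) L
          ≤⟨ ∑sel-mono α L (λ p r _ L↭ → ≤-trans (≤-reflexive (+-identityʳ _)) (ψ-mono (≤-trans (length-filter _ r)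
               (≤-trans (m≤n+m (length r) (length p)) (≤-reflexive (trans (sym (length-++ p)) (trans (sym (↭-length L↭)) |L|))))))) ⟩
        ∑sel α (λ _ _ → ψ (α + m)) L
          ≡⟨ trans (∑sel-const α _ L) (cong (λ l → fall l α * ψ (α + m)) |L|) ⟩
        fall (α + m) α * ψ (α + m) ∎
        where open ≤-Reasoning
      ∑sel-ψ k@(suc k′) m L d k≤α |L| kβ< = begin
        Σψ                                        ≤⟨ m+n≤o⇒m≤o∸n Σψ bound ⟩
        f * X ∸ f * β                             ≡⟨ *-distribˡ-∸ f X β ⟨
        f * (X ∸ β)                               ≤⟨ *-monoʳ-≤ f (≤-trans (∸-monoˡ-≤ β (*-monoʳ-≤ c (*-monoʳ-≤ (suc α) (m≤n+m m α)))) (m≤n⊔m β _)) ⟩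
        f * ψ (α + m)                             ∎
        where
        open ≤-Reasoning
        f = fall (α + m) α
        X = c * (suc α * m)
        G : List Key → List Key → ℕ
        G p r = ∑ (upTo (suc k)) (λ j → ψ (length (section (take k p) r j)))
        N : List Key → List Key → ℕ
        N p r = smallSections (T 12≤c large ∸ α) (take k p) r
        Σψ = ∑sel α G L

        sel-const : ∀ x → ∑sel α (λ _ _ → x) L ≡ f * x
        sel-const x = trans (∑sel-const α x L) (cong (λ l → fall l α * x) |L|)

        pointwise : ∀ p r → length p ≡ α → L ↭ p ++ r → G p r + suc k * β ≤ X + 2 * β * N p r
        pointwise p r |p| L↭ = ≤-trans
          (∑ψ-sections k (take k p) r (trans (length-take k p) (m≤n⇒m⊓n≡m (≤-trans k≤α (≤-reflexive (sym |p|))))))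
          (≤-reflexive (cong (λ l → c * (suc α * l) + 2 * β * N p r)
            (length-rest p |p| |L| L↭)))

        bound : Σψ + f * β ≤ f * X
        -- Of the `suc k` subtracted copies of `β`, `k` pay for the small sections on average;
        -- adding `f * (k * β)` on both sides isolates the one that remains.
        bound = +-cancelʳ-≤ (f * (k * β)) _ _ (begin
          Σψ + f * β + f * (k * β)                                ≡⟨ trans (+-assoc Σψ (f * β) _) (cong (Σψ +_) (sym (*-distribˡ-+ f β (k * β)))) ⟩
          Σψ + f * (suc k * β)                                    ≡⟨ cong (Σψ +_) (sel-const (suc k * β)) ⟨
          Σψ + ∑sel α (λ _ _ → suc k * β) L                       ≡⟨ ∑sel-+ α G (λ _ _ → suc k * β) L ⟨
          ∑sel α (λ p r → G p r + suc k * β) L                    ≤⟨ ∑sel-mono α L pointwise ⟩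
          ∑sel α (λ p r → X + 2 * β * N p r) L                    ≡⟨ ∑sel-+ α (λ _ _ → X) (λ p r → 2 * β * N p r) L ⟩
          ∑sel α (λ _ _ → X) L + ∑sel α (λ p r → 2 * β * N p r) L ≡⟨ cong₂ _+_ (sel-const X) (∑sel-* α (2 * β) N L) ⟩
          f * X + 2 * β * ∑sel α N L                              ≡⟨ cong (f * X +_) (shuffle β (∑sel α N L)) ⟩
          f * X + β * (2 * ∑sel α N L)                            ≤⟨ +-monoʳ-≤ (f * X) (*-monoʳ-≤ β
                                                                       (∑sel-smallSections k (α ∸ k) m L d (m+[n∸m]≡n k≤α) |L| (kβ< k′ refl))) ⟩
          f * X + β * (f * k)                                     ≡⟨ cong (f * X +_) (shuffle′ β f k) ⟩
          f * X + f * (k * β)                                     ∎)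
          where
          shuffle : ∀ a b → 2 * a * b ≡ a * (2 * b)
          shuffle = solve-∀
          shuffle′ : ∀ a b c → a * (b * c) ≡ b * (c * a)
          shuffle′ = solve-∀

      -- The one block is paid by the floor `β` of `ψ`; the term `length L * β` of `Φ` is given
      -- away.
      ∑perm-blockCount-leaf : ∀ L → length L ≤ α → α * β * ∑perm blockCount L ≤ length L ! * Φ (length L)
      ∑perm-blockCount-leaf L L≤α = begin
        α * β * ∑perm blockCount L
          ≤⟨ *-monoʳ-≤ (α * β) (∑sel-mono (length L) L λ p _ |p| _ → blocks-single p _ (≤-trans (≤-reflexive |p|) L≤α)) ⟩
        α * β * ∑sel (length L) (λ _ _ → 1) L
          ≡⟨ cong (α * β *_) (trans (∑sel-const (length L) 1 L) (trans (*-identityʳ _) (fall-self (length L)))) ⟩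
        α * β * length L !
          ≡⟨ *-comm (α * β) (length L !) ⟩
        length L ! * (α * β)
          ≤⟨ *-monoʳ-≤ (length L !) (≤-trans (*-monoʳ-≤ α (β≤ψ (length L))) (m≤n+m _ (length L * β))) ⟩
        length L ! * Φ (length L) ∎
        where open ≤-Reasoning

      -- The root block is paid by `α * β`, the share of its own keys in `Φ`. The keys below it
      -- contribute `m * β` however they are distributed, so only the sum of the `ψ` of the sections
      -- needs averaging, which is `∑sel-ψ`.
      ∑perm-blockCount-split : ∀ k m L → δ α ε (α + m) ≡ suc k → k ≤ α → 0 < m → Distinct L → length L ≡ α + m →
        (∀ R → length R ≤ m → Distinct R → α * β * ∑perm blockCount R ≤ length R ! * Φ (length R)) →
        α * β * ∑sel (α + m) (λ p _ → blockCount p) L ≤ (α + m) ! * Φ (α + m)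
      ∑perm-blockCount-split k m L δ≡ k≤α 0<m d |L| ih = begin
        α * β * ∑sel (α + m) (λ p _ → blockCount p) L
          ≡⟨ cong (α * β *_) (∑sel-∘ α m (λ p _ → blockCount p) L) ⟩
        α * β * ∑sel α (λ p → ∑sel m (λ w _ → blockCount (p ++ w))) L
          ≡⟨ ∑sel-* α (α * β) (λ p → ∑sel m (λ w _ → blockCount (p ++ w))) L ⟨
        ∑sel α (λ p r → α * β * ∑sel m (λ w _ → blockCount (p ++ w)) r) L
          ≤⟨ ∑sel-mono α L (λ p r |p| L↭ → root p r |p| (length-rest p |p| |L| L↭) (Distinct-++ʳ p (Distinct-resp-↭ L↭ d))) ⟩
        ∑sel α (λ p r → m ! * (α * β + m * β + α * G p r)) L
          ≡⟨ ∑sel-* α (m !) (λ p r → α * β + m * β + α * G p r) L ⟩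
        m ! * ∑sel α (λ p r → α * β + m * β + α * G p r) L
          ≡⟨ cong (m ! *_) (trans (∑sel-+ α (λ _ _ → α * β + m * β) (λ p r → α * G p r) L)
               (cong₂ _+_ (trans (∑sel-const α (α * β + m * β) L) (cong (λ l → fall l α * (α * β + m * β)) |L|)) (∑sel-* α α G L))) ⟩
        m ! * (f * (α * β + m * β) + α * ∑sel α G L)
          ≤⟨ *-monoʳ-≤ (m !) (+-monoʳ-≤ (f * (α * β + m * β)) (*-monoʳ-≤ α
               (∑sel-ψ k m L d k≤α |L| λ { k′ refl → δ-bound m k′ δ≡ }))) ⟩
        m ! * (f * (α * β + m * β) + α * (f * ψ (α + m)))
          ≡⟨ collect (m !) f α β m (ψ (α + m)) ⟩
        f * m ! * Φ (α + m)
          ≡⟨ cong (_* Φ (α + m)) (fall-! α m) ⟩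
        (α + m) ! * Φ (α + m) ∎
        where
        open ≤-Reasoning
        f  = fall (α + m) α
        js = upTo (suc k)
        G : List Key → List Key → ℕ
        G p r = ∑ js (λ j → ψ (length (section (take k p) r j)))

        collect : ∀ M f a b m y → M * (f * (a * b + m * b) + a * (f * y)) ≡ f * M * ((a + m) * b + a * y)
        collect = solve-∀

        count : ∀ p w → length p ≡ α → length w ≡ m →
                blockCount (p ++ w) ≡ suc (∑ js (λ j → blockCount (section (take k p) w j)))
        count p w |p| |w| = trans
          (blocks-split (p ++ w) _ (≤-trans (m<m+n α 0<m) (≤-reflexive (sym |pw|))))
          (cong suc (trans
            (cong (λ D → ∑ (upTo D) (λ j → blockCount (section (take (D ∸ 1) (p ++ w)) (drop α (p ++ w)) j)))
                  (trans (cong (δ α ε) |pw|) δ≡))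
            (cong₂ (λ q v → ∑ js (λ j → blockCount (section q v j))) take-k (drop-++-≡ p w |p|))))
          where
          |pw| : length (p ++ w) ≡ α + m
          |pw| = trans (length-++ p) (cong₂ _+_ |p| |w|)
          take-k : take k (p ++ w) ≡ take k p
          take-k = take-++-≤ k p w (≤-trans k≤α (≤-reflexive (sym |p|)))

        -- A section of a random order `w` of `r` is itself in random order, by `∑perm-filter`; the
        -- factor `M !` is introduced to apply that identity and is cancelled afterwards.
        child : ∀ q r j → length r ≡ m → Distinct r →
          α * β * ∑sel m (λ w _ → blockCount (section q w j)) r ≤ m ! * Φ (length (section q r j))
        child q r j |r| dr = *-cancelˡ-≤ (M !) {{M !≢0}} (begin
          M ! * (α * β * ∑sel m (λ w _ → blockCount (section q w j)) r)
            ≡⟨ *-swap (M !) (α * β) _ ⟩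
          α * β * (M ! * ∑sel m (λ w _ → blockCount (section q w j)) r)
            ≡⟨ cong (α * β *_) (∑perm-filter (λ y → rank q y ≟ j) m blockCount r |r|) ⟩
          α * β * (m ! * ∑perm blockCount (section q r j))
            ≡⟨ *-swap (α * β) (m !) _ ⟩
          m ! * (α * β * ∑perm blockCount (section q r j))
            ≤⟨ *-monoʳ-≤ (m !) (ih (section q r j) (≤-trans (length-filter (λ y → rank q y ≟ j) r) (≤-reflexive |r|)) (Distinct-fibre (rank q) j dr)) ⟩
          m ! * (M ! * Φ M)
            ≡⟨ *-swap (m !) (M !) (Φ M) ⟩
          M ! * (m ! * Φ M) ∎)
          where
          M = length (section q r j)

        root : ∀ p r → length p ≡ α → length r ≡ m → Distinct r →
          α * β * ∑sel m (λ w _ → blockCount (p ++ w)) r ≤ m ! * (α * β + m * β + α * G p r)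
        root p r |p| |r| dr = begin
          α * β * ∑sel m (λ w _ → blockCount (p ++ w)) r
            ≡⟨ cong (α * β *_) (∑sel-cong m r λ w _ |w| → count p w |p| |w|) ⟩
          α * β * ∑sel m (λ w _ → suc (∑ js (λ j → blockCount (section (take k p) w j)))) r
            ≡⟨ cong (α * β *_) (trans (∑sel-+ m (λ _ _ → 1) (λ w _ → ∑ js (λ j → blockCount (section (take k p) w j))) r)
                 (cong₂ _+_ (trans (∑sel-const m 1 r) (trans (*-identityʳ _) (trans (cong (λ l → fall l m) |r|) (fall-self m))))
                            (∑sel-∑ m js (λ j w _ → blockCount (section (take k p) w j)) r))) ⟩
          α * β * (m ! + ∑ js X)
            ≡⟨ trans (*-distribˡ-+ (α * β) (m !) (∑ js X)) (cong (α * β * m ! +_) (sym (∑-* (α * β) js X))) ⟩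
          α * β * m ! + ∑ js (λ j → α * β * X j)
            ≤⟨ +-monoʳ-≤ (α * β * m !) (∑-mono js λ {j} _ → child (take k p) r j |r| dr) ⟩
          α * β * m ! + ∑ js (λ j → m ! * Φ (M j))
            ≡⟨ cong (α * β * m ! +_) (trans (∑-* (m !) js (λ j → Φ (M j))) (cong (m ! *_)
                 (trans (∑-+ js (λ j → M j * β) (λ j → α * ψ (M j))) (cong₂ _+_
                   (trans (∑-cong js λ j → *-comm (M j) β) (trans (∑-* β js M) (cong (β *_) (trans (∑-length-section k (take k p) r |take|) |r|))))
                   (∑-* α js (λ j → ψ (M j))))))) ⟩
          α * β * m ! + m ! * (β * m + α * G p r)
            ≡⟨ collect′ (α * β) (m !) β m (α * G p r) ⟩
          m ! * (α * β + m * β + α * G p r) ∎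
          where
          X M : ℕ → ℕ
          X j = ∑sel m (λ w _ → blockCount (section (take k p) w j)) r
          M j = length (section (take k p) r j)
          |take| : length (take k p) ≡ k
          |take| = trans (length-take k p) (m≤n⇒m⊓n≡m (≤-trans k≤α (≤-reflexive (sym |p|))))
          collect′ : ∀ A M b m g → A * M + M * (b * m + g) ≡ M * (A + m * b + g)
          collect′ = solve-∀

      ∑perm-blockCount : ∀ L → Acc _<_ (length L) → Distinct L →
        α * β * ∑perm blockCount L ≤ length L ! * Φ (length L)
      ∑perm-blockCount L (acc rec) d = [ ∑perm-blockCount-leaf L , split ]′ (≤-<-connex (length L) α)
        where
        split : α < length L → α * β * ∑perm blockCount L ≤ length L ! * Φ (length L)
        split α<L = subst (λ l → α * β * ∑sel l (λ p _ → blockCount p) L ≤ l ! * Φ l) α+m≡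
          (∑perm-blockCount-split (proj₁ (δ-suc (α + m))) m L (proj₁ (proj₂ (δ-suc (α + m)))) (proj₂ (proj₂ (δ-suc (α + m))))
            (m<n⇒0<n∸m α<L) d (sym α+m≡)
            λ R R≤ → ∑perm-blockCount R (rec (≤-<-trans R≤ (∸-monoʳ-< {o = 0} (>-nonZero⁻¹ α) (<⇒≤ α<L)))))
          where
          m = length L ∸ α
          α+m≡ : α + m ≡ length L
          α+m≡ = m+[n∸m]≡n (<⇒≤ α<L)

open Counting

open import Data.Fin.Base using (Fin)
open import Data.Fin.Permutation using (Permutation′)
open import Data.Integer.Base as ℤ using (+_; +[1+_]; -[1+_])
import Data.Integer.DivMod as ℤ
import Data.Integer.Properties as ℤ
import Data.Integer.Tactic.RingSolver as ℤSolver
open import Data.List.Base using (List; []; _∷_; map; foldr; length; tabulate)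
open import Data.List.Properties using (length-tabulate)
import Data.List.Relation.Unary.AllPairs.Properties as AllPairs
open import Data.Maybe.Base using (maybe′)
open import Data.Nat.Base as ℕ using (ℕ; zero; suc; NonZero; _!)
open import Data.Nat.Induction using (acc; <-wellFounded)
import Data.Nat.Properties as ℕ
open import Data.Nat.Tactic.RingSolver using (solve-∀)
open import Data.Product.Base using (_×_; _,_; ∃)
open import Data.Rational.Base as ℚ
  using (ℚ; mkℚ; 0ℚ; 1ℚ; ½; Positive; NonNegative; _/_; _+_; _-_; _*_; _≤_; _<_; 1/_; ↥_; ↧_; floor; ceiling; toℚᵘ)
import Data.Rational.Properties as ℚ
open import Data.Rational.Solver using (module +-*-Solver)
open import Data.Rational.Unnormalised.Base as ℚᵘ using (mkℚᵘ; *≡*; _≃_)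
import Data.Rational.Unnormalised.Properties as ℚᵘ
open import Data.Sum.Base using (inj₁; inj₂)
open import Function.Base using (_∘_)
open import Function.Definitions using (Injective)
open import Relation.Binary.Bundles using (StrictTotalOrder)
open import Relation.Binary.Definitions using (tri<; tri≈; tri>)
open import Relation.Binary.PropositionalEquality
open import Relation.Nullary using (contradiction)

-- Natural numbers in ℚ, and ceilings.

toℚᵘ-fromℕ : ∀ m → toℚᵘ (fromℕ m) ≃ mkℚᵘ (+ m) 0
toℚᵘ-fromℕ m = ℚ.toℚᵘ-fromℚᵘ (mkℚᵘ (+ m) 0)

fromℕ-+ : ∀ m n → fromℕ (m ℕ.+ n) ≡ fromℕ m + fromℕ n
fromℕ-+ m n = ℚ.toℚᵘ-injective (begin
  toℚᵘ (fromℕ (m ℕ.+ n))                 ≈⟨ toℚᵘ-fromℕ (m ℕ.+ n) ⟩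
  mkℚᵘ (+ (m ℕ.+ n)) 0                   ≈⟨ *≡* (cong (ℤ._* + 1) (sym (cong₂ ℤ._+_ (ℤ.*-identityʳ (+ m)) (ℤ.*-identityʳ (+ n))))) ⟩
  mkℚᵘ (+ m) 0 ℚᵘ.+ mkℚᵘ (+ n) 0         ≈⟨ ℚᵘ.+-cong (toℚᵘ-fromℕ m) (toℚᵘ-fromℕ n) ⟨
  toℚᵘ (fromℕ m) ℚᵘ.+ toℚᵘ (fromℕ n)     ≈⟨ ℚ.toℚᵘ-homo-+ (fromℕ m) (fromℕ n) ⟨
  toℚᵘ (fromℕ m + fromℕ n)               ∎)
  where open import Relation.Binary.Reasoning.Setoid ℚᵘ.≃-setoid

fromℕ-* : ∀ m n → fromℕ (m ℕ.* n) ≡ fromℕ m * fromℕ n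
fromℕ-* m n = ℚ.toℚᵘ-injective (begin
  toℚᵘ (fromℕ (m ℕ.* n))                 ≈⟨ toℚᵘ-fromℕ (m ℕ.* n) ⟩
  mkℚᵘ (+ (m ℕ.* n)) 0                   ≈⟨ *≡* (cong (ℤ._* + 1) (ℤ.pos-* m n)) ⟩
  mkℚᵘ (+ m) 0 ℚᵘ.* mkℚᵘ (+ n) 0         ≈⟨ ℚᵘ.*-cong (toℚᵘ-fromℕ m) (toℚᵘ-fromℕ n) ⟨
  toℚᵘ (fromℕ m) ℚᵘ.* toℚᵘ (fromℕ n)     ≈⟨ ℚ.toℚᵘ-homo-* (fromℕ m) (fromℕ n) ⟨
  toℚᵘ (fromℕ m * fromℕ n)               ∎)
  where open import Relation.Binary.Reasoning.Setoid ℚᵘ.≃-setoid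

fromℕ-mono-≤ : ∀ {m n} → m ℕ.≤ n → fromℕ m ≤ fromℕ n
fromℕ-mono-≤ {m} {n} m≤n = ℚ.toℚᵘ-cancel-≤ (begin
  toℚᵘ (fromℕ m)  ≃⟨ toℚᵘ-fromℕ m ⟩
  mkℚᵘ (+ m) 0    ≤⟨ ℚᵘ.*≤* (ℤ.*-monoʳ-≤-nonNeg (+ 1) (ℤ.+≤+ m≤n)) ⟩
  mkℚᵘ (+ n) 0    ≃⟨ toℚᵘ-fromℕ n ⟨
  toℚᵘ (fromℕ n)  ∎)
  where open ℚᵘ.≤-Reasoning

fromℕ-cancel-< : ∀ {m n} → fromℕ m < fromℕ n → m ℕ.< n
fromℕ-cancel-< m<n = ℕ.≰⇒> λ n≤m → ℚ.<-irrefl refl (ℚ.<-≤-trans m<n (fromℕ-mono-≤ n≤m))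

fromℕ-cancel-≤ : ∀ {m n} → fromℕ m ≤ fromℕ n → m ℕ.≤ n
fromℕ-cancel-≤ {m} {n} m≤n = ℕ.≮⇒≥ λ n<m → ℚ.<-irrefl refl (begin-strict
  fromℕ n          ≡⟨ ℚ.+-identityʳ (fromℕ n) ⟨
  fromℕ n + 0ℚ     <⟨ ℚ.+-monoʳ-< (fromℕ n) (ℚ.positive⁻¹ 1ℚ) ⟩
  fromℕ n + 1ℚ     ≡⟨ trans (cong fromℕ (ℕ.+-comm 1 n)) (fromℕ-+ n 1) ⟨
  fromℕ (suc n)    ≤⟨ fromℕ-mono-≤ n<m ⟩
  fromℕ m          ≤⟨ m≤n ⟩
  fromℕ n          ∎)
  where open ℚ.≤-Reasoning

fromℕ-pos : ∀ m .{{_ : NonZero m}} → Positive (fromℕ m)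
fromℕ-pos m = ℚ.normalize-pos m 1

/-* : ∀ m n .{{_ : NonZero n}} → (+ m / n) * fromℕ n ≡ fromℕ m
/-* m n@(suc n-1) = ℚ.toℚᵘ-injective (begin
  toℚᵘ ((+ m / n) * fromℕ n)              ≈⟨ ℚ.toℚᵘ-homo-* (+ m / n) (fromℕ n) ⟩
  toℚᵘ (+ m / n) ℚᵘ.* toℚᵘ (fromℕ n)      ≈⟨ ℚᵘ.*-cong (ℚ.toℚᵘ-fromℚᵘ (mkℚᵘ (+ m) n-1)) (toℚᵘ-fromℕ n) ⟩
  mkℚᵘ (+ m) n-1 ℚᵘ.* mkℚᵘ (+ n) 0        ≈⟨ *≡* (trans (ℤ.*-identityʳ (+ m ℤ.* + n)) (cong (+ m ℤ.*_) (cong +_ (sym (ℕ.*-identityʳ n))))) ⟩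
  mkℚᵘ (+ m) 0                            ≈⟨ toℚᵘ-fromℕ m ⟨
  toℚᵘ (fromℕ m)                          ∎)
  where open import Relation.Binary.Reasoning.Setoid ℚᵘ.≃-setoid

-- Division with remainder of `- N`, because the ceiling of `N / D` is defined as minus the floor of
-- `- N / D`, here `- f`. As `r < D`, `N = - f * D - r` exceeds `(- f - 1) * D`.
quotient-< : ∀ N r f D j .{{_ : ℤ.NonNegative D}} → ℤ.- N ≡ r ℤ.+ f ℤ.* D → r ℤ.< D →
             + suc j ℤ.≤ ℤ.- f → + j ℤ.* D ℤ.< N
quotient-< N r f D j -N r<D 1+j≤ = begin-strict
  + j ℤ.* D                          ≡⟨ split (+ j) D ⟨
  (+ 1 ℤ.+ + j) ℤ.* D ℤ.- D          <⟨ ℤ.+-monoʳ-< ((+ 1 ℤ.+ + j) ℤ.* D) (ℤ.neg-mono-< r<D) ⟩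
  + suc j ℤ.* D ℤ.- r                ≤⟨ ℤ.+-monoˡ-≤ (ℤ.- r) (ℤ.*-monoʳ-≤-nonNeg D 1+j≤) ⟩
  ℤ.- f ℤ.* D ℤ.- r                  ≡⟨ negate r f D ⟨
  ℤ.- (r ℤ.+ f ℤ.* D)                ≡⟨ cong ℤ.-_ -N ⟨
  ℤ.- ℤ.- N                          ≡⟨ ℤ.neg-involutive N ⟩
  N                                  ∎
  where
  open ℤ.≤-Reasoning
  split : ∀ j D → (+ 1 ℤ.+ j) ℤ.* D ℤ.- D ≡ j ℤ.* D
  split = ℤSolver.solve-∀
  negate : ∀ r f D → ℤ.- (r ℤ.+ f ℤ.* D) ≡ (ℤ.- f) ℤ.* D ℤ.- r
  negate = ℤSolver.solve-∀

ceiling-< : ∀ p j → + suc j ℤ.≤ ceiling p → fromℕ j < p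
ceiling-< p@(mkℚ N d-1 _) j 1+j≤ = ℚ.toℚᵘ-cancel-< (begin-strict
  toℚᵘ (fromℕ j)  ≃⟨ toℚᵘ-fromℕ j ⟩
  mkℚᵘ (+ j) 0    <⟨ ℚᵘ.*<* (subst (+ j ℤ.* D ℤ.<_) (sym (ℤ.*-identityʳ N)) (quotient-< N (+ r) f D j -N r<D 1+j≤)) ⟩
  mkℚᵘ N d-1      ∎)
  where
  open ℚᵘ.≤-Reasoning
  D = + suc d-1
  q = ℚ.- p
  f = floor q
  -- Negation in ℚ computes only by cases on the numerator, so this holds only propositionally.
  D≡ : ↧ q ≡ D
  D≡ = ℚ.↧-neg p
  floor-↥↧ : ∀ q → floor q ≡ ↥ q ℤ./ ↧ q
  floor-↥↧ q@record{} = refl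
  r = ↥ q ℤ.% ↧ q
  division : ↥ q ≡ + r ℤ.+ f ℤ.* ↧ q
  division = trans (ℤ.a≡a%n+[a/n]*n (↥ q) (↧ q)) (cong (λ f → + r ℤ.+ f ℤ.* ↧ q) (sym (floor-↥↧ q)))
  -N : ℤ.- N ≡ + r ℤ.+ f ℤ.* D
  -N = trans (sym (ℚ.↥-neg p)) (trans division (cong (λ d → + r ℤ.+ f ℤ.* d) D≡))
  r<D : + r ℤ.< D
  r<D = ℤ.<-≤-trans (ℤ.+<+ (ℤ.n%d<d (↥ q) (↧ q))) (ℤ.≤-reflexive (cong (λ z → + ℤ.∣ z ∣) D≡))

clamp-suc : ∀ α z → ∃ λ k → suc α ℕ.⊓ ℤ.∣ + 1 ℤ.⊔ z ∣ ≡ suc k × k ℕ.≤ α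
clamp-suc α (+ zero)  = α ℕ.⊓ 0 , refl , ℕ.m⊓n≤m α 0
clamp-suc α +[1+ n ]  = α ℕ.⊓ n , refl , ℕ.m⊓n≤m α n
clamp-suc α -[1+ n ]  = α ℕ.⊓ 0 , refl , ℕ.m⊓n≤m α 0

-- A value of at least 2 must come from `z`: the minimum with `suc α` only lowers it, and for
-- `z ≤ 0` the inner maximum is 1.
clamp-≤ : ∀ α z k → suc α ℕ.⊓ ℤ.∣ + 1 ℤ.⊔ z ∣ ≡ suc (suc k) → + suc (suc k) ℤ.≤ z
clamp-≤ α (+ zero)  k eq with () ← trans (sym (ℕ.⊓-zeroʳ α)) (ℕ.suc-injective eq)
clamp-≤ α +[1+ n ]  k eq = ℤ.+≤+ (ℕ.s≤s (ℕ.≤-trans (ℕ.≤-reflexive (sym (ℕ.suc-injective eq))) (ℕ.m⊓n≤n α n)))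
clamp-≤ α -[1+ n ]  k eq with () ← trans (sym (ℕ.⊓-zeroʳ α)) (ℕ.suc-injective eq)

-- The parameters ρ and β, and the fan-out δ.

module _ (α : ℕ) .{{_ : NonZero α}} (ε : ℚ) .{{_ : Positive ε}}
         (β : ℕ) (β≡ : fromℕ β ≡ fromℕ (α ℕ.+ 1) * ρ α ε) where

  private instance
    ε≢0 : ℚ.NonZero ε
    ε≢0 = ℚ.pos⇒nonZero ε

  aρ≡β : fromℕ (suc α) * ρ α ε ≡ fromℕ β
  aρ≡β = trans (cong (λ a → fromℕ a * ρ α ε) (ℕ.+-comm 1 α)) (sym β≡)

  βε≡ : fromℕ β * ε ≡ fromℕ (108 ℕ.* α ℕ.* suc α)
  βε≡ = begin
    fromℕ β * ε                                        ≡⟨ cong (_* ε) aρ≡β ⟨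
    fromℕ (suc α) * (fromℕ (108 ℕ.* α) * 1/ ε) * ε     ≡⟨ solve 4 (λ a b i e → a :* (b :* i) :* e := b :* a :* (i :* e)) refl (fromℕ (suc α)) (fromℕ (108 ℕ.* α)) (1/ ε) ε ⟩
    fromℕ (108 ℕ.* α) * fromℕ (suc α) * (1/ ε * ε)     ≡⟨ cong₂ _*_ (sym (fromℕ-* (108 ℕ.* α) (suc α))) (ℚ.*-inverseˡ ε) ⟩
    fromℕ (108 ℕ.* α ℕ.* suc α) * 1ℚ                   ≡⟨ ℚ.*-identityʳ _ ⟩
    fromℕ (108 ℕ.* α ℕ.* suc α)                        ∎
    where
    open ≡-Reasoning
    open +-*-Solver

  -- For `ε ≤ ½` twice β ε is at most β, and `βε≡` turns β ε into a natural number. In terms of ρ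
  -- this says ρ ≥ 216 α.
  β-large : ε ≤ ½ → 2 ℕ.* (108 ℕ.* α ℕ.* suc α) ℕ.≤ β
  β-large ε≤½ = fromℕ-cancel-≤ (begin
    fromℕ (2 ℕ.* X)            ≡⟨ fromℕ-* 2 X ⟩
    fromℕ 2 * fromℕ X          ≡⟨ cong (fromℕ 2 *_) (sym βε≡) ⟩
    fromℕ 2 * (fromℕ β * ε)    ≤⟨ ℚ.*-monoˡ-≤-nonNeg (fromℕ 2) (ℚ.*-monoˡ-≤-nonNeg (fromℕ β) {{ℚ.normalize-nonNeg β 1}} ε≤½) ⟩
    fromℕ 2 * (fromℕ β * ½)    ≡⟨ trans (cong (fromℕ 2 *_) (ℚ.*-comm (fromℕ β) ½)) (sym (ℚ.*-assoc (fromℕ 2) ½ (fromℕ β))) ⟩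
    1ℚ * fromℕ β               ≡⟨ ℚ.*-identityˡ _ ⟩
    fromℕ β                    ∎)
    where
    open ℚ.≤-Reasoning
    X = 108 ℕ.* α ℕ.* suc α

  private
    ρ-pos : Positive (ρ α ε)
    ρ-pos = ℚ.pos*pos⇒pos (fromℕ (108 ℕ.* α)) {{fromℕ-pos (108 ℕ.* α) {{ℕ.m*n≢0 108 α}}}} (1/ ε) {{ℚ.1/pos⇒pos ε}}

  ratio : ℕ → ℚ
  ratio s = ℚ._÷_ (fromℕ s - fromℕ α) (ρ α ε) {{ρ≢0 α ε}}

  δ-suc : ∀ s → ∃ λ k → δ α ε s ≡ suc k × k ℕ.≤ α
  δ-suc s = clamp-suc α (ceiling (ratio s))

  -- A fan-out of `2 + k` forces the ceiling of m / ρ to be at least `2 + k`, hence m > (1 + k) ρ;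
  -- multiplying by `suc α` replaces ρ by the integer `β`.
  δ-bound : ∀ m k → δ α ε (α ℕ.+ m) ≡ 2 ℕ.+ k → suc k ℕ.* β ℕ.< suc α ℕ.* m
  δ-bound m k δ≡ = fromℕ-cancel-< (begin-strict
    fromℕ (suc k ℕ.* β)                      ≡⟨ trans (fromℕ-* (suc k) β) (cong (fromℕ (suc k) *_) (sym aρ≡β)) ⟩
    fromℕ (suc k) * (α⁺ * r)                  ≡⟨ solve 3 (λ k a r → k :* (a :* r) := a :* (k :* r)) refl (fromℕ (suc k)) α⁺ r ⟩
    α⁺ * (fromℕ (suc k) * r)                  <⟨ ℚ.*-monoʳ-<-pos α⁺ {{fromℕ-pos (suc α)}} (ℚ.*-monoˡ-<-pos r {{ρ-pos}} (ceiling-< x (suc k) (clamp-≤ α (ceiling x) k δ≡))) ⟩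
    α⁺ * (x * r)                              ≡⟨ cong (α⁺ *_) xr≡ ⟩
    α⁺ * fromℕ m                              ≡⟨ fromℕ-* (suc α) m ⟨
    fromℕ (suc α ℕ.* m)                      ∎)
    where
    open ℚ.≤-Reasoning
    open +-*-Solver
    α⁺ = fromℕ (suc α)
    r = ρ α ε
    x = ratio (α ℕ.+ m)
    xr≡ : x * r ≡ fromℕ m
    xr≡ = trans (ℚ.*-assoc (fromℕ (α ℕ.+ m) - fromℕ α) ((1/ r) {{ρ≢0 α ε}}) r)
      (trans (cong₂ _*_ (trans (cong (_- fromℕ α) (fromℕ-+ α m)) (solve 2 (λ a m → a :+ m :- a := m) refl (fromℕ α) (fromℕ m))) (ℚ.*-inverseˡ r {{ρ≢0 α ε}}))
             (ℚ.*-identityʳ _))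

-- The inequality behind the load-factor.

module _ where
  open +-*-Solver

  square-nonNeg : ∀ p → 0ℚ ≤ p * p
  square-nonNeg p with ℚ.≤-total 0ℚ p
  ... | inj₁ 0≤p = ℚ.≤-trans (ℚ.≤-reflexive (sym (ℚ.*-zeroˡ p))) (ℚ.*-monoʳ-≤-nonNeg p {{ℚ.nonNegative 0≤p}} 0≤p)
  ... | inj₂ p≤0 = ℚ.≤-trans (ℚ.≤-reflexive (sym (ℚ.*-zeroˡ p))) (ℚ.*-monoʳ-≤-nonPos p {{ℚ.nonPositive p≤0}} p≤0)

  -- ℓ + s / y ≥ 2 for ℓ = y / s, multiplied by y.
  tangent : ∀ ℓ s y .{{_ : Positive s}} → ℓ * s ≡ y → y + y ≤ ℓ * y + s
  tangent ℓ s y ℓs≡y = ℚ.*-cancelʳ-≤-pos s (begin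
    (y + y) * s                          ≡⟨ ℚ.+-identityʳ _ ⟨
    (y + y) * s + 0ℚ                     ≤⟨ ℚ.+-monoʳ-≤ ((y + y) * s) (square-nonNeg (y - s)) ⟩
    (y + y) * s + (y - s) * (y - s)      ≡⟨ solve 2 (λ y s → (y :+ y) :* s :+ (y :- s) :* (y :- s) := y :* y :+ s :* s) refl y s ⟩
    y * y + s * s                        ≡⟨ cong (λ z → z * y + s * s) ℓs≡y ⟨
    ℓ * s * y + s * s                    ≡⟨ solve 3 (λ ℓ s y → ℓ :* s :* y :+ s :* s := (ℓ :* y :+ s) :* s) refl ℓ s y ⟩
    (ℓ * y + s) * s                      ∎)
    where open ℚ.≤-Reasoning

-- Rational sums and linearity of `𝔼`.

module _ {X : Set} where

  ∑ℚ : List X → (X → ℚ) → ℚ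
  ∑ℚ xs f = foldr _+_ 0ℚ (map f xs)

  ∑ℚ-mono : ∀ xs {f g} → (∀ x → f x ≤ g x) → ∑ℚ xs f ≤ ∑ℚ xs g
  ∑ℚ-mono []       f≤g = ℚ.≤-refl
  ∑ℚ-mono (x ∷ xs) f≤g = ℚ.+-mono-≤ (f≤g x) (∑ℚ-mono xs f≤g)

  ∑ℚ-+ : ∀ xs f g → ∑ℚ xs (λ x → f x + g x) ≡ ∑ℚ xs f + ∑ℚ xs g
  ∑ℚ-+ []       f g = sym (ℚ.+-identityʳ 0ℚ)
  ∑ℚ-+ (x ∷ xs) f g = trans (cong (λ z → (f x + g x) + z) (∑ℚ-+ xs f g))
    (solve 4 (λ a b c d → (a :+ b) :+ (c :+ d) := (a :+ c) :+ (b :+ d)) refl (f x) (g x) (∑ℚ xs f) (∑ℚ xs g))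
    where open +-*-Solver

  ∑ℚ-* : ∀ xs f y → ∑ℚ xs (λ x → f x * y) ≡ ∑ℚ xs f * y
  ∑ℚ-* []       f y = sym (ℚ.*-zeroˡ y)
  ∑ℚ-* (x ∷ xs) f y = trans (cong (λ z → f x * y + z) (∑ℚ-* xs f y)) (sym (ℚ.*-distribʳ-+ y (f x) (∑ℚ xs f)))

  ∑ℚ-fromℕ : ∀ xs f → ∑ℚ xs (fromℕ ∘ f) ≡ fromℕ (∑ xs f)
  ∑ℚ-fromℕ []       f = refl
  ∑ℚ-fromℕ (x ∷ xs) f = trans (cong (λ z → fromℕ (f x) + z) (∑ℚ-fromℕ xs f)) (sym (fromℕ-+ (f x) (∑ xs f)))

module _ (n : ℕ) where

  private
    perms = permutations n
    i : ℚ
    i = _/_ (+ 1) (n !) {{n ℕ.!≢0}}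

    i-nonNeg : NonNegative i
    i-nonNeg = ℚ.normalize-nonNeg 1 (n !) {{n ℕ.!≢0}}

    n!*i : fromℕ (n !) * i ≡ 1ℚ
    n!*i = trans (ℚ.*-comm (fromℕ (n !)) i) (/-* 1 (n !) {{n ℕ.!≢0}})

  𝔼-mono : ∀ {f g : Permutation′ n → ℚ} → (∀ π → f π ≤ g π) → 𝔼 f ≤ 𝔼 g
  𝔼-mono f≤g = ℚ.*-monoʳ-≤-nonNeg i {{i-nonNeg}} (∑ℚ-mono perms f≤g)

  𝔼-+ : ∀ (f g : Permutation′ n → ℚ) → 𝔼 (λ π → f π + g π) ≡ 𝔼 f + 𝔼 g
  𝔼-+ f g = trans (cong (_* i) (∑ℚ-+ perms f g)) (ℚ.*-distribʳ-+ i (∑ℚ perms f) (∑ℚ perms g))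

  𝔼-* : ∀ (f : Permutation′ n → ℚ) y → 𝔼 (λ π → f π * y) ≡ 𝔼 f * y
  𝔼-* f y = trans (cong (_* i) (∑ℚ-* perms f y))
    (solve 3 (λ a b c → (a :* b) :* c := (a :* c) :* b) refl (∑ℚ perms f) y i)
    where open +-*-Solver

  𝔼-fromℕ : ∀ (f : Permutation′ n → ℕ) → 𝔼 (fromℕ ∘ f) * fromℕ (n !) ≡ fromℕ (∑ perms f)
  𝔼-fromℕ f = begin
    ∑ℚ perms (fromℕ ∘ f) * i * fromℕ (n !)     ≡⟨ ℚ.*-assoc (∑ℚ perms (fromℕ ∘ f)) i (fromℕ (n !)) ⟩
    ∑ℚ perms (fromℕ ∘ f) * (i * fromℕ (n !))   ≡⟨ cong₂ _*_ (∑ℚ-fromℕ perms f) (/-* 1 (n !) {{n ℕ.!≢0}}) ⟩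
    fromℕ (∑ perms f) * 1ℚ                     ≡⟨ ℚ.*-identityʳ _ ⟩
    fromℕ (∑ perms f)                          ∎
    where open ≡-Reasoning

  𝔼-const : ∀ y → 𝔼 {n} (λ _ → y) ≡ y
  𝔼-const y = begin
    𝔼 {n} (λ _ → y)                    ≡⟨ cong (λ z → z * i) (trans (cong (λ y → ∑ℚ perms (λ _ → y)) (sym (ℚ.*-identityˡ y))) (∑ℚ-* perms (λ _ → 1ℚ) y)) ⟩
    ∑ℚ perms (λ _ → 1ℚ) * y * i        ≡⟨ cong (λ z → z * y * i) (trans (∑ℚ-fromℕ perms (λ _ → 1)) (cong fromℕ (trans (∑-const perms 1) (trans (ℕ.*-identityʳ _) (length-permutations n))))) ⟩
    fromℕ (n !) * y * i                ≡⟨ solve 3 (λ a b c → a :* b :* c := (a :* c) :* b) refl (fromℕ (n !)) y i ⟩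
    fromℕ (n !) * i * y                ≡⟨ cong (_* y) n!*i ⟩
    1ℚ * y                             ≡⟨ ℚ.*-identityˡ y ⟩
    y                                  ∎
    where
    open ≡-Reasoning
    open +-*-Solver

-- Size and load-factor of the random tree.

module _ {c ℓ₁ ℓ₂} (U : StrictTotalOrder c ℓ₁ ℓ₂) (α : ℕ) .{{_ : NonZero α}} (ε : ℚ) .{{_ : Positive ε}} where

  open StrictTotalOrder U using (_≈_; compare) renaming (Carrier to Key)
  open RBST U α ε using (size; loadFactor; build; byPriority)
  open SmallSections U using (Apart; Distinct)
  open Size U α ε using (blockCount; ∑perm-blockCount)

  tabulate-distinct : ∀ {n} (x : Fin n → Key) → Injective _≡_ _≈_ x → Distinct (tabulate x)
  tabulate-distinct x x-inj = AllPairs.tabulate⁺ apart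
    where
    apart : ∀ {i j} → i ≢ j → Apart (x i) (x j)
    apart {i} {j} i≢j with compare (x i) (x j)
    ... | tri< lt _ _ = inj₁ lt
    ... | tri≈ _ eq _ = contradiction (x-inj eq) i≢j
    ... | tri> _ _ gt = inj₂ gt

  blocks-nonZero : ∀ Y a → NonZero (length Y) → NonZero (maybe′ blocks 0 (build Y a))
  blocks-nonZero (y ∷ ys) (acc rec) _ = root-nonZero _
    where
    root-nonZero : ∀ (t : Tree Key) → NonZero (blocks t)
    root-nonZero (block _ _ _) = _

  -- This excludes the conventional value of `loadFactor` at size 0.
  size-nonZero : ∀ n .{{_ : NonZero n}} (x : Fin n → Key) π → NonZero (size x π)
  size-nonZero (suc n) x π = blocks-nonZero (byPriority x π) (<-wellFounded _) _

  loadFactor-* : ∀ {n} (x : Fin n → Key) π → NonZero (size x π) → loadFactor x π * fromℕ (size x π) ≡ + n / α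
  loadFactor-* {n} x π nz with size x π
  ... | suc s = ℚ.≤-antisym (le {p = l * S} {q = y} eq) (le {p = y} {q = l * S} (sym eq))
    where
    l = _/_ (+ n) (α ℕ.* suc s) {{ℕ.m*n≢0 α (suc s)}}
    S = fromℕ (suc s)
    y = + n / α
    le : ∀ {p q} → p * fromℕ α ≡ q * fromℕ α → p ≤ q
    le e = ℚ.*-cancelʳ-≤-pos (fromℕ α) {{fromℕ-pos α}} (ℚ.≤-reflexive e)
    eq : l * S * fromℕ α ≡ y * fromℕ α
    eq = begin
      l * S * fromℕ α             ≡⟨ solve 3 (λ l s a → l :* s :* a := l :* (a :* s)) refl l S (fromℕ α) ⟩
      l * (fromℕ α * S)           ≡⟨ cong (l *_) (fromℕ-* α (suc s)) ⟨
      l * fromℕ (α ℕ.* suc s)     ≡⟨ /-* n (α ℕ.* suc s) {{ℕ.m*n≢0 α (suc s)}} ⟩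
      fromℕ n                     ≡⟨ /-* n α ⟨
      y * fromℕ α                 ∎
      where
      open ≡-Reasoning
      open +-*-Solver

  module _ (ε≤½ : ε ≤ ½) (β : ℕ) (β≡ : fromℕ β ≡ fromℕ (α ℕ.+ 1) * ρ α ε)
           (n : ℕ) (α+β≤n : α ℕ.+ β ℕ.≤ n) (x : Fin n → Key) (x-inj : Injective _≡_ _≈_ x) where

    private
      -- Equal to β ε, by `βε≡`: divided by `α * β`, the term `C * n` becomes ε n / α, the excess
      -- over n / α.
      C : ℕ
      C = 108 ℕ.* α ℕ.* suc α

    ∑-size : α ℕ.* β ℕ.* ∑ (permutations n) (size x) ℕ.≤ n ! ℕ.* (n ℕ.* β ℕ.+ C ℕ.* n)
    ∑-size = begin
      α ℕ.* β ℕ.* ∑ (permutations n) (size x)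
        ≡⟨ cong (α ℕ.* β ℕ.*_) (∑-permutations n x blockCount) ⟩
      α ℕ.* β ℕ.* ∑perm blockCount (tabulate x)
        ≤⟨ ∑perm-blockCount β 108 (ℕ.m≤m+n 12 96) large (δ-suc α ε β β≡) (δ-bound α ε β β≡)
             (tabulate x) (<-wellFounded _) (tabulate-distinct x x-inj) ⟩
      length (tabulate x) ! ℕ.* Φ (length (tabulate x))
        ≡⟨ cong (λ l → l ! ℕ.* Φ l) (length-tabulate x) ⟩
      n ! ℕ.* (n ℕ.* β ℕ.+ α ℕ.* ψ n)
        ≤⟨ ℕ.*-monoʳ-≤ (n !) (ℕ.+-monoʳ-≤ (n ℕ.* β) (ℕ.*-monoʳ-≤ α ψ≤)) ⟩
      n ! ℕ.* (n ℕ.* β ℕ.+ α ℕ.* (108 ℕ.* (suc α ℕ.* n)))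
        ≡⟨ cong (λ z → n ! ℕ.* (n ℕ.* β ℕ.+ z)) (shuffle 108 α (suc α) n) ⟩
      n ! ℕ.* (n ℕ.* β ℕ.+ C ℕ.* n) ∎
      where
      open ℕ.≤-Reasoning
      open Potential α β 108 using (Φ; ψ)
      shuffle : ∀ c a b n → a ℕ.* (c ℕ.* (b ℕ.* n)) ≡ c ℕ.* a ℕ.* b ℕ.* n
      shuffle = solve-∀
      shuffle′ : ∀ c a b → 2 ℕ.* c ℕ.* (a ℕ.* b) ≡ 2 ℕ.* (c ℕ.* a ℕ.* b)
      shuffle′ = solve-∀
      large : 2 ℕ.* 108 ℕ.* (α ℕ.* suc α) ℕ.≤ β
      large = ℕ.≤-trans (ℕ.≤-reflexive (shuffle′ 108 α (suc α))) (β-large α ε β β≡ ε≤½)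
      -- The size condition on `n` acts here: by `β ≤ n` the constant branch of `ψ` is at most the
      -- linear term, and the other branch is bounded by dropping the subtracted `β`.
      ψ≤ : ψ n ℕ.≤ 108 ℕ.* (suc α ℕ.* n)
      ψ≤ = ℕ.⊔-lub (ℕ.≤-trans (ℕ.≤-trans (ℕ.m≤n+m β α) α+β≤n)
                     (ℕ.≤-trans (ℕ.m≤n*m n (suc α)) (ℕ.m≤n*m (suc α ℕ.* n) 108)))
                   (ℕ.m∸n≤m _ β)

    private
      y : ℚ
      y = + n / α

      instance
        β≢0 : NonZero β
        β≢0 = ℕ.>-nonZero (ℕ.≤-trans (ℕ.>-nonZero⁻¹ (2 ℕ.* C) {{ℕ.m*n≢0 2 C {{_}} {{ℕ.m*n≢0 (108 ℕ.* α) (suc α) {{ℕ.m*n≢0 108 α}}}}}}) (β-large α ε β β≡ ε≤½))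
        n≢0 : NonZero n
        n≢0 = ℕ.>-nonZero (ℕ.≤-trans (ℕ.≤-trans (ℕ.>-nonZero⁻¹ β) (ℕ.m≤n+m β α)) α+β≤n)
        n!≢0 : NonZero (n !)
        n!≢0 = n ℕ.!≢0

    -- `∑-size` divided by `α * β * n !`, with n = (n / α) α and `C` = β ε substituted.
    𝔼-size : 𝔼 (λ π → fromℕ (size x π)) ≤ (1ℚ + ε) * y
    𝔼-size = ℚ.*-cancelʳ-≤-pos D {{D-pos}} (begin
      E * D
        ≡⟨ solve 4 (λ e a b f → e :* (a :* b :* f) := a :* b :* (e :* f)) refl E (fromℕ α) (fromℕ β) (fromℕ (n !)) ⟩
      fromℕ α * fromℕ β * (E * fromℕ (n !))
        ≡⟨ cong₂ _*_ (sym (fromℕ-* α β)) (𝔼-fromℕ n (size x)) ⟩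
      fromℕ (α ℕ.* β) * fromℕ (∑ (permutations n) (size x))
        ≡⟨ fromℕ-* (α ℕ.* β) (∑ (permutations n) (size x)) ⟨
      fromℕ (α ℕ.* β ℕ.* ∑ (permutations n) (size x))
        ≤⟨ fromℕ-mono-≤ ∑-size ⟩
      fromℕ (n ! ℕ.* (n ℕ.* β ℕ.+ C ℕ.* n))
        ≡⟨ trans (fromℕ-* (n !) _) (cong (fromℕ (n !) *_) (trans (fromℕ-+ (n ℕ.* β) (C ℕ.* n)) (cong₂ _+_ (fromℕ-* n β) (fromℕ-* C n)))) ⟩
      fromℕ (n !) * (fromℕ n * fromℕ β + fromℕ C * fromℕ n)
        ≡⟨ cong₂ (λ m d → fromℕ (n !) * (m * fromℕ β + d * m)) (sym (/-* n α)) (sym (βε≡ α ε β β≡)) ⟩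
      fromℕ (n !) * (y * fromℕ α * fromℕ β + fromℕ β * ε * (y * fromℕ α))
        ≡⟨ solve 5 (λ f y a b e → f :* (y :* a :* b :+ b :* e :* (y :* a)) := (con 1ℚ :+ e) :* y :* (a :* b :* f)) refl (fromℕ (n !)) y (fromℕ α) (fromℕ β) ε ⟩
      (1ℚ + ε) * y * D ∎)
      where
      open ℚ.≤-Reasoning
      open +-*-Solver
      E = 𝔼 (λ π → fromℕ (size x π))
      D = fromℕ α * fromℕ β * fromℕ (n !)
      D-pos : Positive D
      D-pos = ℚ.pos*pos⇒pos (fromℕ α * fromℕ β) {{ℚ.pos*pos⇒pos (fromℕ α) {{fromℕ-pos α}} (fromℕ β) {{fromℕ-pos β}}}} (fromℕ (n !)) {{fromℕ-pos (n !)}}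

    -- The load-factor is convex in the size, and `tangent` is its tangent line at size n / α. That
    -- line is linear in the size, so its expectation is controlled by `𝔼-size` alone.
    𝔼-loadFactor : 1ℚ - ε ≤ 𝔼 (loadFactor x)
    𝔼-loadFactor = ℚ.*-cancelʳ-≤-pos y {{ℚ.normalize-pos n α}} (begin
      (1ℚ - ε) * y
        ≡⟨ solve 2 (λ e y → (con 1ℚ :- e) :* y := (y :+ y) :- (con 1ℚ :+ e) :* y) refl ε y ⟩
      y + y - (1ℚ + ε) * y
        ≡⟨ cong (_- (1ℚ + ε) * y) (𝔼-const n (y + y)) ⟨
      𝔼 {n} (λ _ → y + y) - (1ℚ + ε) * y
        ≤⟨ ℚ.+-monoˡ-≤ (ℚ.- ((1ℚ + ε) * y)) (𝔼-mono n λ π →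
             tangent (loadFactor x π) (fromℕ (size x π)) y {{fromℕ-pos (size x π) {{size-nonZero n x π}}}} (loadFactor-* x π (size-nonZero n x π))) ⟩
      𝔼 (λ π → loadFactor x π * y + fromℕ (size x π)) - (1ℚ + ε) * y
        ≡⟨ cong (_- (1ℚ + ε) * y) (trans (𝔼-+ n (λ π → loadFactor x π * y) (λ π → fromℕ (size x π))) (cong (_+ E) (𝔼-* n (loadFactor x) y))) ⟩
      𝔼 (loadFactor x) * y + E - (1ℚ + ε) * y
        ≤⟨ ℚ.+-monoˡ-≤ (ℚ.- ((1ℚ + ε) * y)) (ℚ.+-monoʳ-≤ (𝔼 (loadFactor x) * y) 𝔼-size) ⟩
      𝔼 (loadFactor x) * y + (1ℚ + ε) * y - (1ℚ + ε) * y
        ≡⟨ solve 2 (λ l z → l :+ z :- z := l) refl (𝔼 (loadFactor x) * y) ((1ℚ + ε) * y) ⟩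
      𝔼 (loadFactor x) * y ∎)
      where
      open ℚ.≤-Reasoning
      open +-*-Solver
      E = 𝔼 (λ π → fromℕ (size x π))

corollary8 : ∀ {c ℓ₁ ℓ₂} (U : StrictTotalOrder c ℓ₁ ℓ₂)
    (α : ℕ) .{{_ : NonZero α}} (ε : ℚ) .{{_ : Positive ε}} → ε ≤ ½ →
    (β : ℕ) → fromℕ β ≡ fromℕ (α ℕ.+ 1) * ρ α ε →
    (n : ℕ) → α ℕ.+ β ℕ.≤ n →
    (x : Fin n → StrictTotalOrder.Carrier U) → Injective _≡_ (StrictTotalOrder._≈_ U) x →
    (𝔼 (λ π → fromℕ (RBST.size U α ε x π)) ≤ (1ℚ + ε) * (+ n / α))
    × (1ℚ - ε ≤ 𝔼 (RBST.loadFactor U α ε x))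
corollary8 U α ε ε≤½ β β≡ n α+β≤n x x-inj =
  𝔼-size U α ε ε≤½ β β≡ n α+β≤n x x-inj , 𝔼-loadFactor U α ε ε≤½ β β≡ n α+β≤n x x-inj
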